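{- For every integer $n\ge 2$, $$WL(Q_n,C_{2^n})=WL(Q_n,C_{2^n};\xi_n)=3\cdot 2^{2n-3}-2^{n-1}.$$
   Context: $Q_n$ is the $n$-dimensional hypercube: vertex set $\{0,1\}^n$, two vertices adjacent iff they differ in exactly one coordinate. $C_N$ is the cycle with vertex set $\{1,\dots,N\}$ and edges $\{i,i+1\}$ ($1\le i<N$) and $\{N,1\}$. An embedding of $Q_n$ into $C_{2^n}$ is a bijection $\eta:\{0,1\}^n\to\{1,\dots,2^n\}$, and its wirelength is $WL(Q_n,C_{2^n};\eta)=\sum_{\{u,v\}\in E(Q_n)} d(\eta(u),\eta(v))$, where $d(a,b)=\min(|a-b|,2^n-|a-b|)$ is the shortest-path distance in $C_{2^n}$. $WL(Q_n,C_{2^n})$ is the minimum of $WL(Q_n,C_{2^n};\eta)$ over all embeddings $\eta$. The Gray code embedding $\xi_n$ is defined as follows: for $x=x_1\cdots x_n\in\{0,1\}^n$ let $y=y_1\cdots y_n$ with $y_i=0$ if $x_1+\cdots+x_i$ is even and $y_i=1$ otherwise; then $\xi_n(x)=(y)_2+1$, where $(y)_2$ is the integer with binary expansion $y$. -}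

module Defs where

open import Data.Bool using (Bool; true; false; not; _xor_)
open import Data.Nat using (ℕ; zero; suc; _+_; _*_; _^_; _∸_; _⊓_; ∣_-_∣)
open import Data.Fin using (Fin; toℕ)
open import Data.Vec using (Vec; []; _∷_; lookup; _[_]%=_)
open import Data.List using (List; []; _∷_; map; concatMap; _++_)
open import Data.Nat.ListAction using (sum)
open import Data.List using (allFin)
open import Function.Bundles using (_⤖_; Bijection)

allVertices : (n : ℕ) → List (Vec Bool n)
allVertices zero = [] ∷ []
allVertices (suc n) = map (false ∷_) (allVertices n) ++ map (true ∷_) (allVertices n)

flip : {n : ℕ} → Fin n → Vec Bool n → Vec Bool n
flip i u = u [ i ]%= not

cycDist : ℕ → ℕ → ℕ → ℕ
cycDist N a b = ∣ a - b ∣ ⊓ (N ∸ ∣ a - b ∣)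

-- Each edge {u, flip i u} of Q_n is counted exactly once, via its endpoint u
-- with u_i = 0.
edgeCost : {n : ℕ} → (Vec Bool n → ℕ) → Vec Bool n → Fin n → ℕ
edgeCost {n} f u i with lookup u i
... | false = cycDist (2 ^ n) (f u) (f (flip i u))
... | true  = 0

WLfun : (n : ℕ) → (Vec Bool n → ℕ) → ℕ
WLfun n f = sum (concatMap (λ u → map (edgeCost f u) (allFin n)) (allVertices n))

Embedding : ℕ → Set
Embedding n = Vec Bool n ⤖ Fin (2 ^ n)

pos : {n : ℕ} → Embedding n → Vec Bool n → ℕ
pos η u = suc (toℕ (Bijection.to η u))

WL : (n : ℕ) → Embedding n → ℕ
WL n η = WLfun n (pos η)

-- Gray code: y_i = x_1 xor … xor x_i
prefixXor : {n : ℕ} → Bool → Vec Bool n → Vec Bool n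
prefixXor acc [] = []
prefixXor acc (x ∷ xs) = (acc xor x) ∷ prefixXor (acc xor x) xs

bit : Bool → ℕ
bit false = 0
bit true = 1

binVal : {n : ℕ} → ℕ → Vec Bool n → ℕ
binVal acc [] = acc
binVal acc (y ∷ ys) = binVal (2 * acc + bit y) ys

ξ : (n : ℕ) → Vec Bool n → ℕ
ξ n x = suc (binVal 0 (prefixXor false x))

{-# OPTIONS --safe #-}

-- Let N = 2^n and H = N/2.  The distance of two points of the cycle is the number of the H
-- antipodal cuts separating them, so the wirelength is the sum over k < H of the edge
-- boundaries of the sets A_k of vertices placed in [k , k + H); all of these have size H.
--
-- Fix a coordinate i and let t(k) be the number of vertices of A_k with u_i = 0.  Harper's
-- inequality in both facets bounds the boundary of A_k below by Φ(t(k)), where Φ is built from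
-- the Takagi function.  Moving k by one changes t by at most one, and going on
-- around the cycle t turns into H - t after H steps.  So if t = 0 somewhere, then t sweeps all
-- of [0 , H), and the sum of Φ over [0 , H) is exactly the wirelength of the Gray code.
--
-- In general let τ be the least distance of any A_k from any facet.  The sweep then misses the
-- 2τ extreme levels and has 2τ surplus steps instead, and it suffices that every boundary is at
-- least the average of Φ over the missing levels.  This follows from the bound by Φ at a
-- coordinate in which A_k is neither very unbalanced nor nearly balanced.  If A_k is nearly
-- balanced in all coordinates, then its level-one Fourier weight W is at most ε times its
-- total influence I, and I ≥ 2 - W makes the boundary large.
module Submission where

open import Defs
open import Data.Bool using (Bool; true; false; not; _xor_; if_then_else_)
open import Data.Bool.Properties using (xor-comm; xor-identityʳ; not-distribˡ-xor)
open import Data.Fin using (Fin; zero; suc; toℕ; fromℕ<)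
open import Data.Fin.Properties using (any?; toℕ-fromℕ<; toℕ<n; toℕ-injective)
open import Data.List using (List; map; concatMap; allFin; tabulate)
open import Data.List.Properties using (concatMap-++; concatMap-map; map-tabulate)
open import Data.Nat.ListAction as List using ()
open import Data.Nat.ListAction.Properties using (sum-++)
open import Data.Product using (_×_; Σ; ∃; _,_; proj₁; proj₂)
open import Data.Sum using (_⊎_; inj₁; inj₂; [_,_]′)
open import Data.Vec using (Vec; []; _∷_; lookup; insertAt)
open import Function using (_∘_; id)
open import Function.Bundles using (Bijection; mk⤖)
open import Relation.Binary.PropositionalEquality
open import Relation.Nullary using (yes; no; contradiction)

module Isoperimetry where

  open import Data.Nat
  open import Data.Nat.Properties
  open import Data.Nat.Tactic.RingSolver using (solve-∀)
  open import Algebra.Properties.CommutativeMonoid.Sum +-0-commutativeMonoid using (sum; sum-cong-≗)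

  -- Sums over the vertices and the edges of the cube.

  ∑ : ∀ {n} → (Vec Bool n → ℕ) → ℕ
  ∑ {zero}  f = f []
  ∑ {suc n} f = ∑ (λ w → f (false ∷ w)) + ∑ (λ w → f (true ∷ w))

  ∑-mono : ∀ {n} {f g : Vec Bool n → ℕ} → (∀ u → f u ≤ g u) → ∑ f ≤ ∑ g
  ∑-mono {zero}  f≤g = f≤g []
  ∑-mono {suc n} f≤g = +-mono-≤ (∑-mono (f≤g ∘ (false ∷_))) (∑-mono (f≤g ∘ (true ∷_)))

  ∑-cong : ∀ {n} {f g : Vec Bool n → ℕ} → (∀ u → f u ≡ g u) → ∑ f ≡ ∑ g
  ∑-cong {zero}  f≡g = f≡g []
  ∑-cong {suc n} f≡g = cong₂ _+_ (∑-cong (f≡g ∘ (false ∷_))) (∑-cong (f≡g ∘ (true ∷_)))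

  interchange : ∀ a b c d → (a + b) + (c + d) ≡ (a + c) + (b + d)
  interchange = solve-∀

  ∑-+ : ∀ {n} (f g : Vec Bool n → ℕ) → ∑ (λ u → f u + g u) ≡ ∑ f + ∑ g
  ∑-+ {zero}  f g = refl
  ∑-+ {suc n} f g = trans (cong₂ _+_ (∑-+ {n} _ _) (∑-+ {n} _ _))
    (interchange (∑ (f ∘ (false ∷_))) (∑ (g ∘ (false ∷_))) (∑ (f ∘ (true ∷_))) (∑ (g ∘ (true ∷_))))

  ∑-const : ∀ n c → ∑ {n} (λ _ → c) ≡ 2 ^ n * c
  ∑-const zero    c = sym (+-identityʳ c)
  ∑-const (suc n) c rewrite ∑-const n c = double (2 ^ n) c
    where
    double : ∀ x y → x * y + x * y ≡ (x + (x + 0)) * y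
    double = solve-∀

  ∑-zero : ∀ {n} {f : Vec Bool n → ℕ} → (∀ u → f u ≡ 0) → ∑ f ≡ 0
  ∑-zero {n} f≡0 = trans (∑-cong f≡0) (trans (∑-const n 0) (*-zeroʳ (2 ^ n)))

  ∑-single : ∀ {n} (f : Vec Bool n → ℕ) u → (∀ v → v ≢ u → f v ≡ 0) → ∑ f ≡ f u
  ∑-single f [] _ = refl
  ∑-single f (false ∷ u) off = trans
    (cong₂ _+_ (∑-single _ u (λ v v≢u → off (false ∷ v) (λ { refl → v≢u refl })))
               (∑-zero (λ v → off (true ∷ v) (λ ()))))
    (+-identityʳ _)
  ∑-single f (true ∷ u) off =
    cong₂ _+_ (∑-zero (λ v → off (false ∷ v) (λ ())))
              (∑-single _ u (λ v v≢u → off (true ∷ v) (λ { refl → v≢u refl })))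

  ∑-insertAt : ∀ {n} (i : Fin (suc n)) (f : Vec Bool (suc n) → ℕ) →
    ∑ f ≡ ∑ (λ w → f (insertAt w i false)) + ∑ (λ w → f (insertAt w i true))
  ∑-insertAt zero f = refl
  ∑-insertAt {suc n} (suc i) f = trans
    (cong₂ _+_ (∑-insertAt i (f ∘ (false ∷_))) (∑-insertAt i (f ∘ (true ∷_))))
    (interchange (∑ (λ w → f (false ∷ insertAt w i false))) (∑ (λ w → f (false ∷ insertAt w i true))) (∑ (λ w → f (true ∷ insertAt w i false))) _)

  -- Each edge occurs once, its `false` endpoint being the first argument of `c`, which is the
  -- convention of `edgeCost`. Peeling off one coordinate gives the later inductions their shape:
  -- two facets and a perfect matching between them.
  edges : ∀ {n} {X : Set} → (X → X → ℕ) → (Vec Bool n → X) → ℕ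
  edges {zero}  c f = 0
  edges {suc n} c f = edges c (λ w → f (false ∷ w)) + edges c (λ w → f (true ∷ w))
    + ∑ (λ w → c (f (false ∷ w)) (f (true ∷ w)))

  edges-mono : ∀ {n} {X Y : Set} {c : X → X → ℕ} {d : Y → Y → ℕ} {f : Vec Bool n → X} {g : Vec Bool n → Y} →
    (∀ u v → c (f u) (f v) ≤ d (g u) (g v)) → edges c f ≤ edges d g
  edges-mono {zero}  le = z≤n
  edges-mono {suc n} {c = c} {d} le = +-mono-≤
    (+-mono-≤ (edges-mono {c = c} {d} (λ u v → le (false ∷ u) (false ∷ v)))
              (edges-mono {c = c} {d} (λ u v → le (true ∷ u) (true ∷ v))))
    (∑-mono (λ w → le (false ∷ w) (true ∷ w)))

  edges-+ : ∀ {n} {X : Set} (c d : X → X → ℕ) (f : Vec Bool n → X) →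
    edges (λ x y → c x y + d x y) f ≡ edges c f + edges d f
  edges-+ {zero}  c d f = refl
  edges-+ {suc n} c d f = trans
    (cong₂ _+_ (cong₂ _+_ (edges-+ c d (f ∘ (false ∷_))) (edges-+ c d (f ∘ (true ∷_)))) (∑-+ {n} _ _))
    (rearrange (edges c (f ∘ (false ∷_))) (edges d (f ∘ (false ∷_))) (edges c (f ∘ (true ∷_))) _ _ _)
    where
    rearrange : ∀ a b c d e f → ((a + b) + (c + d)) + (e + f) ≡ ((a + c) + e) + ((b + d) + f)
    rearrange = solve-∀

  cost : ∀ {n} {X : Set} → (X → X → ℕ) → (Vec Bool n → X) → Vec Bool n → Fin n → ℕ
  cost c f u i = if lookup u i then 0 else c (f u) (f (flip i u))

  edgeCost≡cost : ∀ {n} (f : Vec Bool n → ℕ) u i → edgeCost f u i ≡ cost (cycDist (2 ^ n)) f u i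
  edgeCost≡cost f u i with lookup u i
  ... | false = refl
  ... | true  = refl

  ∑-cost : ∀ {n} {X : Set} (c : X → X → ℕ) (f : Vec Bool n → X) →
    ∑ (λ u → sum (cost c f u)) ≡ edges c f
  ∑-cost {zero}  c f = refl
  ∑-cost {suc n} c f = trans
    (cong₂ _+_
      (trans (∑-+ (λ w → c (f (false ∷ w)) (f (true ∷ w))) (λ w → sum (cost c (f ∘ (false ∷_)) w)))
             (cong (∑ (λ w → c (f (false ∷ w)) (f (true ∷ w))) +_) (∑-cost c (f ∘ (false ∷_)))))
      (∑-cost c (f ∘ (true ∷_))))
    (rearrange (∑ (λ w → c (f (false ∷ w)) (f (true ∷ w)))) _ _)
    where
    rearrange : ∀ a b c → (a + b) + c ≡ (b + c) + a
    rearrange = solve-∀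

  sum-allVertices : ∀ {n} (h : Vec Bool n → List ℕ) →
    List.sum (concatMap h (allVertices n)) ≡ ∑ (λ u → List.sum (h u))
  sum-allVertices {zero}  h = trans (sum-++ (h []) _) (+-identityʳ _)
  sum-allVertices {suc n} h = trans
    (cong List.sum (concatMap-++ h (map (false ∷_) (allVertices n)) _))
    (trans (sum-++ (concatMap h (map (false ∷_) (allVertices n))) _)
           (cong₂ _+_ (half false) (half true)))
    where
    half : ∀ b → List.sum (concatMap h (map (b ∷_) (allVertices n))) ≡ ∑ (λ w → List.sum (h (b ∷ w)))
    half b = trans (cong List.sum (concatMap-map h (b ∷_) (allVertices n))) (sum-allVertices (h ∘ (b ∷_)))

  sum-allFin : ∀ n (g : Fin n → ℕ) → List.sum (map g (allFin n)) ≡ sum g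
  sum-allFin n g = trans (cong List.sum (map-tabulate id g)) (go n g)
    where
    go : ∀ n (g : Fin n → ℕ) → List.sum (tabulate g) ≡ sum g
    go zero    g = refl
    go (suc n) g = cong (g zero +_) (go n (g ∘ suc))

  WLfun≡edges : ∀ n (f : Vec Bool n → ℕ) → WLfun n f ≡ edges (cycDist (2 ^ n)) f
  WLfun≡edges n f = trans (sum-allVertices (λ u → map (edgeCost f u) (allFin n))) (trans
    (∑-cong (λ u → trans (sum-allFin n _) (sum-cong-≗ (edgeCost≡cost f u))))
    (∑-cost (cycDist (2 ^ n)) f))

  -- The discrete Takagi function and its subadditivity.

  fold : ℕ → ℕ → ℕ
  fold m t = t ⊓ (2 ^ suc m ∸ t)

  -- θ m t = 2^m T(t / 2^m) with T the Takagi function; by Harper's theorem this is the least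
  -- edge boundary of a set of t vertices of Q_m.
  θ : ℕ → ℕ → ℕ
  θ zero    t = 0
  θ (suc m) t = fold m t + θ m (fold m t)

  -- Linear arithmetic without subtraction: a combination `l ≤ r` of known inequalities is compared
  -- with the goal after the common terms `s` are added to it, so that only two equations remain,
  -- mostly for the ring solver.
  ≤-cancelling : ∀ s {l r x y} → l ≤ r → x + s ≡ l → r ≡ y + s → x ≤ y
  ≤-cancelling s {x = x} {y} l≤r refl refl = +-cancelʳ-≤ s x y l≤r

  2^suc : ∀ m → 2 ^ suc m ≡ 2 ^ m + 2 ^ m
  2^suc m = cong (2 ^ m +_) (+-identityʳ (2 ^ m))

  fold-low : ∀ m {t} → t ≤ 2 ^ m → fold m t ≡ t
  fold-low m {t} t≤ = m≤n⇒m⊓n≡m (m+n≤o⇒m≤o∸n t (subst (t + t ≤_) (sym (2^suc m)) (+-mono-≤ t≤ t≤)))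

  fold-sym : ∀ m {t t′} → t + t′ ≡ 2 ^ suc m → fold m t ≡ fold m t′
  fold-sym m {t} {t′} eq rewrite sym eq | m+n∸m≡n t t′ | m+n∸n≡m t t′ = ⊓-comm t t′

  fold-high : ∀ m {t t′} → t + t′ ≡ 2 ^ suc m → t′ ≤ 2 ^ m → fold m t ≡ t′
  fold-high m eq t′≤ = trans (fold-sym m eq) (fold-low m t′≤)

  θ-low : ∀ m {t} → t ≤ 2 ^ m → θ (suc m) t ≡ t + θ m t
  θ-low m t≤ = cong (λ x → x + θ m x) (fold-low m t≤)

  θ-high : ∀ m {t t′} → t + t′ ≡ 2 ^ suc m → t′ ≤ 2 ^ m → θ (suc m) t ≡ t′ + θ m t′
  θ-high m eq t′≤ = cong (λ x → x + θ m x) (fold-high m eq t′≤)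

  θ-sym : ∀ m {t t′} → t + t′ ≡ 2 ^ m → θ m t ≡ θ m t′
  θ-sym zero    eq = refl
  θ-sym (suc m) eq = cong (λ x → x + θ m x) (fold-sym m eq)

  θ-zero : ∀ m → θ m 0 ≡ 0
  θ-zero zero    = refl
  θ-zero (suc m) = θ-zero m

  complement : ∀ {t M} → t ≤ M → ∃ λ t′ → t + t′ ≡ M
  complement {t} {M} t≤M = M ∸ t , m+[n∸m]≡n t≤M

  complement-≤ : ∀ M {t t′} → t + t′ ≡ M + M → M ≤ t → t′ ≤ M
  complement-≤ M {t} {t′} eq M≤t = +-cancelˡ-≤ M t′ M (subst (M + t′ ≤_) eq (+-monoˡ-≤ t′ M≤t))

  -- Subadditivity with a gain of twice the smaller part, as if sets of `a` and `b` vertices could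
  -- always be placed side by side with `a` edges between them, each of which leaves both
  -- boundaries.
  Splits : ℕ → Set
  Splits m = ∀ {a b} → a ≤ b → a + b ≤ 2 ^ m → θ m (a + b) + (a + a) ≤ θ m a + θ m b

  splits⇒subadditive : ∀ m → Splits m → ∀ a b → a + b ≤ 2 ^ m → θ m (a + b) ≤ θ m a + θ m b
  splits⇒subadditive m split a b a+b≤ with ≤-total a b
  ... | inj₁ a≤b = ≤-trans (m≤m+n _ _) (split a≤b a+b≤)
  ... | inj₂ b≤a = subst₂ _≤_ (cong (θ m) (+-comm b a)) (+-comm (θ m b) (θ m a))
    (≤-trans (m≤m+n _ _) (split b≤a (subst (_≤ 2 ^ m) (+-comm a b) a+b≤)))

  module _ m (split : Splits m) {a b : ℕ} (a≤b : a ≤ b) where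

    splits-low : a + b ≤ 2 ^ m → θ (suc m) (a + b) + (a + a) ≤ θ (suc m) a + θ (suc m) b
    splits-low lo
      rewrite θ-low m lo | θ-low m (≤-trans (m≤m+n a b) lo) | θ-low m (≤-trans (m≤n+m b a) lo) =
      ≤-cancelling 0 (+-monoʳ-≤ (a + b) (split a≤b lo))
        (lhs a b (θ m (a + b))) (rhs a b (θ m a) (θ m b))
      where
      lhs : ∀ a b x → a + b + x + (a + a) + 0 ≡ a + b + (x + (a + a))
      lhs = solve-∀
      rhs : ∀ a b x y → a + b + (x + y) ≡ a + x + (b + y) + 0
      rhs = solve-∀

    -- Complements exchange the roles of the smaller and the larger part: `a + b` reflects to
    -- `b′ + a′`, where the gain is `b′ + b′`. The linear terms turn this into the gain `a + a`.
    splits-straddling : 2 ^ m ≤ a + b → b ≤ 2 ^ m → θ (suc m) (a + b) + (a + a) ≤ θ (suc m) a + θ (suc m) b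
    splits-straddling hi b≤ with complement (≤-trans a≤b b≤) | complement b≤
    ... | a′ , aa′ | b′ , bb′ = begin
      θ (suc m) (a + b) + (a + a)      ≡⟨ cong (_+ (a + a)) (θ-high m {a + b} {b′ + a′} (trans total (sym (2^suc m))) sum≤) ⟩
      b′ + a′ + θ m (b′ + a′) + (a + a) ≤⟨ ≤-cancelling (b′ + b′) (+-monoʳ-≤ (b′ + a′ + a + a) (split b′≤a′ sum≤))
        (lhs a a′ b′ (θ m (b′ + a′)))
        (trans (rhs₁ a a′ b′ (θ m a′) (θ m b′)) (trans (cong (λ z → z + a + b′ + θ m a′ + θ m b′) (trans aa′ (sym bb′))) (rhs₂ a b b′ (θ m a′) (θ m b′)))) ⟩
      a + θ m a′ + (b + θ m b′)        ≡⟨ cong₂ (λ x y → a + x + (b + y)) (θ-sym m aa′) (θ-sym m bb′) ⟨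
      a + θ m a + (b + θ m b)          ≡⟨ cong₂ _+_ (θ-low m (≤-trans a≤b b≤)) (θ-low m b≤) ⟨
      θ (suc m) a + θ (suc m) b        ∎
      where
      open ≤-Reasoning
      four : ∀ a b c d → (a + b) + (d + c) ≡ (a + c) + (b + d)
      four = solve-∀
      total : (a + b) + (b′ + a′) ≡ 2 ^ m + 2 ^ m
      total = trans (four a b a′ b′) (cong₂ _+_ aa′ bb′)
      sum≤ : b′ + a′ ≤ 2 ^ m
      sum≤ = complement-≤ (2 ^ m) total hi
      b′≤a′ : b′ ≤ a′
      b′≤a′ = ≤-cancelling a (+-monoˡ-≤ b′ a≤b) (+-comm b′ a) (trans bb′ (trans (sym aa′) (+-comm a a′)))
      lhs : ∀ a a′ b′ x → b′ + a′ + x + (a + a) + (b′ + b′) ≡ b′ + a′ + a + a + (x + (b′ + b′))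
      lhs = solve-∀
      rhs₁ : ∀ a a′ b′ x y → b′ + a′ + a + a + (y + x) ≡ (a + a′) + a + b′ + x + y
      rhs₁ = solve-∀
      rhs₂ : ∀ a b b′ x y → (b + b′) + a + b′ + x + y ≡ a + x + (b + y) + (b′ + b′)
      rhs₂ = solve-∀

    -- The reflection `a + c` of `b` exceeds the reflection `c` of `a + b` by `a`. So the linear
    -- terms alone supply the gain `a + a`, and plain subadditivity of `θ m` finishes; it is applied
    -- to `a` and `d`, whose order is unknown.
    splits-high : a + b ≤ 2 ^ suc m → 2 ^ m ≤ b → θ (suc m) (a + b) + (a + a) ≤ θ (suc m) a + θ (suc m) b
    splits-high a+b≤ b≥ with complement a+b≤
    ... | c , abc with complement (complement-≤ (2 ^ m) {b} {a + c} (trans (swap a b c) (trans abc (2^suc m))) b≥)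
      where
      swap : ∀ a b c → b + (a + c) ≡ (a + b) + c
      swap = solve-∀
    ... | d , acd = begin
      θ (suc m) (a + b) + (a + a)        ≡⟨ cong (_+ (a + a)) (θ-high m abc (≤-trans (m≤n+m c a) a+c≤)) ⟩
      c + θ m c + (a + a)                ≡⟨ cong (λ x → c + x + (a + a)) (θ-sym m (trans (swap₂ a c d) acd)) ⟩
      c + θ m (a + d) + (a + a)          ≤⟨ +-monoˡ-≤ (a + a) (+-monoʳ-≤ c (splits⇒subadditive m split a d a+d≤)) ⟩
      c + (θ m a + θ m d) + (a + a)      ≡⟨ rearrange a c (θ m a) (θ m d) ⟩
      a + θ m a + (a + c + θ m d)        ≡⟨ cong₂ _+_ (θ-low m (≤-trans (m≤m+n a c) a+c≤))
                                              (trans (θ-high m (trans (swap a b c) abc) a+c≤) (cong (a + c +_) (θ-sym m acd))) ⟨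
      θ (suc m) a + θ (suc m) b          ∎
      where
      open ≤-Reasoning
      swap : ∀ a b c → b + (a + c) ≡ (a + b) + c
      swap = solve-∀
      swap₂ : ∀ a c d → c + (a + d) ≡ a + c + d
      swap₂ = solve-∀
      a+c≤ : a + c ≤ 2 ^ m
      a+c≤ = m+n≤o⇒m≤o (a + c) (≤-reflexive acd)
      a+d≤ : a + d ≤ 2 ^ m
      a+d≤ = m+n≤o⇒n≤o c (≤-reflexive (trans (swap₂ a c d) acd))
      rearrange : ∀ a c x y → c + (x + y) + (a + a) ≡ a + x + (a + c + y)
      rearrange = solve-∀

  θ-splits : ∀ m → Splits m
  θ-splits zero {zero} a≤b a+b≤1 = z≤n
  θ-splits zero {suc a} {suc b} a≤b (s≤s a+b≤0) with () ← subst (_≤ 0) (+-suc a b) a+b≤0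
  θ-splits (suc m) {a} {b} a≤b a+b≤ with a + b ≤? 2 ^ m | b ≤? 2 ^ m
  ... | yes lo | _     = splits-low m (θ-splits m) a≤b lo
  ... | no hi | yes b≤ = splits-straddling m (θ-splits m) a≤b (<⇒≤ (≰⇒> hi)) b≤
  ... | no _ | no b≰   = splits-high m (θ-splits m) a≤b a+b≤ (<⇒≤ (≰⇒> b≰))

  -- The arithmetic of Harper's induction: `a` and `b` are the sizes in the two facets and `g`
  -- bounds their difference. In the lower half the linear term `a + b` less the gain `a + a` is
  -- just `b - a`; the upper half follows for the complements, which have the same difference.
  θ-merge : ∀ m {a b} → a ≤ b → b ≤ 2 ^ m → ∀ {g} → b ≤ a + g → θ (suc m) (a + b) ≤ θ m a + θ m b + g
  θ-merge m {a} {b} a≤b b≤ {g} b≤a+g with a + b ≤? 2 ^ m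
  ... | yes lo rewrite θ-low m lo =
    ≤-cancelling (a + a) (+-mono-≤ (θ-splits m a≤b lo) (+-monoʳ-≤ a b≤a+g)) (lhs a b (θ m (a + b))) (rhs a g (θ m a) (θ m b))
    where
    lhs : ∀ a b x → a + b + x + (a + a) ≡ x + (a + a) + (a + b)
    lhs = solve-∀
    rhs : ∀ a g x y → x + y + (a + (a + g)) ≡ x + y + g + (a + a)
    rhs = solve-∀
  ... | no hi with complement (≤-trans a≤b b≤) | complement b≤
  ... | a′ , aa′ | b′ , bb′ = begin
    θ (suc m) (a + b)              ≡⟨ θ-high m {a + b} {b′ + a′} (trans total (sym (2^suc m))) sum≤ ⟩
    b′ + a′ + θ m (b′ + a′)        ≤⟨ ≤-cancelling (b′ + b′) (+-mono-≤ (θ-splits m b′≤a′ sum≤) (+-monoʳ-≤ b′ a′≤b′+g)) (lhs b′ a′ (θ m (b′ + a′))) (rhs b′ g (θ m b′) (θ m a′)) ⟩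
    θ m a′ + θ m b′ + g            ≡⟨ cong₂ (λ x y → x + y + g) (θ-sym m aa′) (θ-sym m bb′) ⟨
    θ m a + θ m b + g              ∎
    where
    open ≤-Reasoning
    four : ∀ a b c d → (a + b) + (d + c) ≡ (a + c) + (b + d)
    four = solve-∀
    total : (a + b) + (b′ + a′) ≡ 2 ^ m + 2 ^ m
    total = trans (four a b a′ b′) (cong₂ _+_ aa′ bb′)
    sum≤ : b′ + a′ ≤ 2 ^ m
    sum≤ = complement-≤ (2 ^ m) total (<⇒≤ (≰⇒> hi))
    b′≤a′ : b′ ≤ a′
    b′≤a′ = ≤-cancelling a (+-monoˡ-≤ b′ a≤b) (+-comm b′ a) (trans bb′ (trans (sym aa′) (+-comm a a′)))
    a′≤b′+g : a′ ≤ b′ + g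
    a′≤b′+g = ≤-cancelling a (≤-trans (≤-reflexive (trans aa′ (sym bb′))) (+-monoˡ-≤ b′ b≤a+g)) (+-comm a′ a) (cyc a b′ g)
      where
      cyc : ∀ a b g → (a + g) + b ≡ (b + g) + a
      cyc = solve-∀
    lhs : ∀ b a x → b + a + x + (b + b) ≡ x + (b + b) + (b + a)
    lhs = solve-∀
    rhs : ∀ b g x y → x + y + (b + (b + g)) ≡ y + x + g + (b + b)
    rhs = solve-∀

  θ-harper : ∀ m {a b} → a ≤ 2 ^ m → b ≤ 2 ^ m → ∀ {g} → b ≤ a + g → a ≤ b + g →
    θ (suc m) (a + b) ≤ θ m a + θ m b + g
  θ-harper m {a} {b} a≤ b≤ {g} b≤a+g a≤b+g with ≤-total a b
  ... | inj₁ a≤b = θ-merge m a≤b b≤ b≤a+g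
  ... | inj₂ b≤a = subst₂ _≤_ (cong (θ (suc m)) (+-comm b a)) (cong (_+ g) (+-comm (θ m b) (θ m a))) (θ-merge m b≤a a≤ a≤b+g)

  -- Areas under the Takagi function.

  half-≤ : ∀ {x y} → x + x ≤ y + y → x ≤ y
  half-≤ {x} {y} le with x ≤? y
  ... | yes x≤y = x≤y
  ... | no x≰y = contradiction le (<⇒≱ (+-mono-< (≰⇒> x≰y) (≰⇒> x≰y)))

  -- Twice the area under the piecewise linear interpolation of `θ m` over [0 , τ]. For `τ ≤ 2 ^ m`
  -- it is also the sum of `θ m ∘ fold m` over the `2τ` extreme levels of [0 , 2 ^ suc m), those
  -- that a sweep misses.
  trapezoid : ℕ → ℕ → ℕ
  trapezoid m zero    = 0
  trapezoid m (suc τ) = trapezoid m τ + (θ m τ + θ m (suc τ))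

  trapezoid-suc : ∀ m {τ} → τ ≤ 2 ^ m → trapezoid (suc m) τ ≡ trapezoid m τ + τ * τ
  trapezoid-suc m {zero}  τ≤ = refl
  trapezoid-suc m {suc τ} τ≤
    rewrite trapezoid-suc m (<⇒≤ τ≤) | θ-low m (<⇒≤ τ≤) | θ-low m τ≤ =
    identity (trapezoid m τ) τ (θ m τ) (θ m (suc τ))
    where
    identity : ∀ f t x y → f + t * t + (t + x + (suc t + y)) ≡ f + (x + y) + suc t * suc t
    identity = solve-∀

  trapezoid-reflect : ∀ m {τ τ′} → τ + τ′ ≡ 2 ^ m → trapezoid m τ + trapezoid m τ′ ≡ trapezoid m (2 ^ m)
  trapezoid-reflect m {zero}  refl = refl
  trapezoid-reflect m {suc τ} {τ′} eq = trans
    (trans (cong (λ x → trapezoid m τ + x + trapezoid m τ′)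
             (cong₂ _+_ (θ-sym m {τ} eq′) (θ-sym m eq)))
           (identity (trapezoid m τ) (trapezoid m τ′) (θ m (suc τ′)) (θ m τ′)))
    (trapezoid-reflect m {τ} {suc τ′} eq′)
    where
    eq′ : τ + suc τ′ ≡ 2 ^ m
    eq′ = trans (+-suc τ τ′) eq
    identity : ∀ f g x y → f + (x + y) + g ≡ f + (g + (y + x))
    identity = solve-∀

  -- The two halves have equal area, so `trapezoid-suc` at the midpoint gives a recursion in `m`.
  trapezoid-total : ∀ m → trapezoid m (2 ^ m) + 2 ^ m ≡ 2 ^ m * 2 ^ m
  trapezoid-total zero    = refl
  trapezoid-total (suc m) = begin
    trapezoid (suc m) (2 ^ suc m) + 2 ^ suc m
      ≡⟨ cong₂ _+_ (sym (trapezoid-reflect (suc m) {2 ^ m} (sym (2^suc m)))) (2^suc m) ⟩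
    trapezoid (suc m) M + trapezoid (suc m) M + (M + M)
      ≡⟨ cong (λ x → x + x + (M + M)) (trapezoid-suc m ≤-refl) ⟩
    trapezoid m M + M * M + (trapezoid m M + M * M) + (M + M)
      ≡⟨ identity₁ (trapezoid m M) M ⟩
    (trapezoid m M + M) + (trapezoid m M + M) + (M * M + M * M)
      ≡⟨ cong (λ x → x + x + (M * M + M * M)) (trapezoid-total m) ⟩
    M * M + M * M + (M * M + M * M)
      ≡⟨ identity₂ M ⟩
    (M + M) * (M + M)
      ≡⟨ cong (λ x → x * x) (2^suc m) ⟨
    2 ^ suc m * 2 ^ suc m ∎
    where
    open ≡-Reasoning
    M = 2 ^ m
    identity₁ : ∀ f x → f + x * x + (f + x * x) + (x + x) ≡ (f + x) + (f + x) + (x * x + x * x)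
    identity₁ = solve-∀
    identity₂ : ∀ x → x * x + x * x + (x * x + x * x) ≡ (x + x) * (x + x)
    identity₂ = solve-∀

  θ-≥ : ∀ m {t t′} → t + t′ ≡ 2 ^ m → t ≤ t′ → t ≤ θ m t
  θ-≥ zero {zero} eq t≤t′ = z≤n
  θ-≥ zero {suc t} {suc t′} eq t≤t′ with () ← trans (sym (+-suc t t′)) (suc-injective eq)
  θ-≥ (suc m) {t} {t′} eq t≤t′ = ≤-trans (m≤m+n t (θ m t)) (≤-reflexive (sym (θ-low m
    (half-≤ (≤-trans (+-monoʳ-≤ t t≤t′) (≤-reflexive (trans eq (2^suc m))))))))

  trapezoid-≥ : ∀ m {τ τ′} → τ + τ′ ≡ 2 ^ m → τ ≤ τ′ → τ * τ ≤ trapezoid m τ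
  trapezoid-≥ m {zero} eq τ≤τ′ = z≤n
  trapezoid-≥ m {suc τ} {τ′} eq τ<τ′ = subst (_≤ trapezoid m (suc τ)) (identity τ)
    (+-mono-≤ (trapezoid-≥ m eq′ τ≤) (+-mono-≤ (θ-≥ m eq′ τ≤) (θ-≥ m eq τ<τ′)))
    where
    eq′ : τ + suc τ′ ≡ 2 ^ m
    eq′ = trans (+-suc τ τ′) eq
    τ≤ : τ ≤ suc τ′
    τ≤ = ≤-trans (n≤1+n τ) (≤-trans τ<τ′ (n≤1+n τ′))
    identity : ∀ t → t * t + (t + suc t) ≡ suc t * suc t
    identity = solve-∀

  -- Induction through `trapezoid-suc`. When `τ` lies beyond half of the smaller range, its area
  -- there is the total less the area up to the complement `y`, and the latter is at least `y * y`.
  trapezoid-≤ : ∀ m {τ} → τ + τ ≤ 2 ^ m → trapezoid m τ ≤ τ * 2 ^ m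
  trapezoid-≤ zero {zero} le = z≤n
  trapezoid-≤ zero {suc τ} (s≤s le) with () ← subst (_≤ 0) (+-suc τ τ) le
  trapezoid-≤ (suc m) {τ} le with half-≤ (subst (τ + τ ≤_) (2^suc m) le)
  ... | τ≤ with τ + τ ≤? 2 ^ m
  ... | yes lo = begin
    trapezoid (suc m) τ      ≡⟨ trapezoid-suc m τ≤ ⟩
    trapezoid m τ + τ * τ    ≤⟨ +-mono-≤ (trapezoid-≤ m {τ} lo) (*-monoʳ-≤ τ τ≤) ⟩
    τ * 2 ^ m + τ * 2 ^ m    ≡⟨ *-distribˡ-+ τ (2 ^ m) (2 ^ m) ⟨
    τ * (2 ^ m + 2 ^ m)      ≡⟨ cong (τ *_) (2^suc m) ⟨
    τ * 2 ^ suc m            ∎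
    where open ≤-Reasoning
  ... | no hi with complement τ≤
  ... | y , τy = ≤-cancelling (y * y + trapezoid m y)
    (+-mono-≤ (+-monoˡ-≤ (τ * τ) area≤) (trapezoid-≥ m (trans (+-comm y τ) τy) y≤τ))
    lhs rhs
    where
    y≤τ : y ≤ τ
    y≤τ = +-cancelˡ-≤ τ y τ (≤-trans (≤-reflexive τy) (<⇒≤ (≰⇒> hi)))
    area≤ : trapezoid m τ + trapezoid m y ≤ 2 ^ m * 2 ^ m
    area≤ = m+n≤o⇒m≤o _ (≤-reflexive (trans (cong (_+ 2 ^ m) (trapezoid-reflect m {τ} τy)) (trapezoid-total m)))
    lhs : trapezoid (suc m) τ + (y * y + trapezoid m y) ≡ trapezoid m τ + trapezoid m y + τ * τ + y * y
    lhs rewrite trapezoid-suc m τ≤ = identity (trapezoid m τ) (trapezoid m y) τ y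
      where
      identity : ∀ f g t y → f + t * t + (y * y + g) ≡ f + g + t * t + y * y
      identity = solve-∀
    rhs : 2 ^ m * 2 ^ m + τ * τ + trapezoid m y ≡ τ * 2 ^ suc m + (y * y + trapezoid m y)
    rhs = trans (cong (λ x → x * x + τ * τ + trapezoid m y) (sym τy))
      (trans (identity τ y (trapezoid m y))
      (cong (λ x → τ * x + (y * y + trapezoid m y)) (trans (cong₂ _+_ τy τy) (sym (2^suc m)))))
      where
      identity : ∀ t y g → (t + y) * (t + y) + t * t + g ≡ t * (t + y + (t + y)) + (y * y + g)
      identity = solve-∀

  -- Two terms of the Takagi series suffice: `s` itself, and `s′` as a lower bound for `θ m s′`.
  θ-middle : ∀ m {s} → s ≤ 2 ^ m → 2 ^ m ≤ s + s → 2 ^ m ≤ θ (suc m) s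
  θ-middle m {s} s≤ ≤2s with complement s≤
  ... | s′ , ss′ = begin
    2 ^ m        ≡⟨ ss′ ⟨
    s + s′       ≤⟨ +-monoʳ-≤ s (θ-≥ m (trans (+-comm s′ s) ss′) (+-cancelˡ-≤ s s′ s (≤-trans (≤-reflexive ss′) ≤2s))) ⟩
    s + θ m s′   ≡⟨ cong (s +_) (θ-sym m ss′) ⟨
    s + θ m s    ≡⟨ θ-low m s≤ ⟨
    θ (suc m) s  ∎
    where open ≤-Reasoning

  -- `rec` is the induction hypothesis of `trapezoid-≤-θ`, handed over so that it serves both `σ`
  -- and its reflection. If `σ + τ` exceeds `2 ^ m`, then `σ` lies between a quarter and a half of
  -- the range, and `2 ^ m` separates the mean over [0 , τ] from `θ (suc m) σ`.
  trapezoid-≤-θ-low : ∀ m {τ σ} → (∀ {τ σ} → τ ≤ σ → σ + τ ≤ 2 ^ m → trapezoid m τ ≤ (τ + τ) * θ m σ) →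
    τ ≤ σ → σ ≤ 2 ^ m → trapezoid (suc m) τ ≤ (τ + τ) * θ (suc m) σ
  trapezoid-≤-θ-low m {τ} {σ} rec τ≤σ σ≤ with σ + τ ≤? 2 ^ m
  ... | yes lo = begin
    trapezoid (suc m) τ                    ≡⟨ trapezoid-suc m (≤-trans τ≤σ σ≤) ⟩
    trapezoid m τ + τ * τ                  ≤⟨ +-mono-≤ (rec τ≤σ lo) (*-mono-≤ (m≤m+n τ τ) τ≤σ) ⟩
    (τ + τ) * θ m σ + (τ + τ) * σ          ≡⟨ identity (τ + τ) σ (θ m σ) ⟩
    (τ + τ) * (σ + θ m σ)                  ≡⟨ cong ((τ + τ) *_) (θ-low m σ≤) ⟨
    (τ + τ) * θ (suc m) σ                  ∎
    where
    open ≤-Reasoning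
    identity : ∀ a s x → a * x + a * s ≡ a * (s + x)
    identity = solve-∀
  ... | no hi = begin
    trapezoid (suc m) τ        ≤⟨ trapezoid-≤ (suc m) {τ} (≤-trans (+-mono-≤ τ≤ τ≤) (≤-reflexive (sym (2^suc m)))) ⟩
    τ * 2 ^ suc m              ≡⟨ cong (τ *_) (2^suc m) ⟩
    τ * (2 ^ m + 2 ^ m)        ≡⟨ identity τ (2 ^ m) ⟩
    (τ + τ) * 2 ^ m            ≤⟨ *-monoʳ-≤ (τ + τ) (θ-middle m σ≤ (≤-trans (<⇒≤ (≰⇒> hi)) (+-monoʳ-≤ σ τ≤σ))) ⟩
    (τ + τ) * θ (suc m) σ      ∎
    where
    open ≤-Reasoning
    τ≤ = ≤-trans τ≤σ σ≤
    identity : ∀ t M → t * (M + M) ≡ (t + t) * M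
    identity = solve-∀

  -- `θ m` is not monotone up to the midpoint, but at a level at least as central as all of [0 , τ]
  -- it is no less than its mean over that interval.
  trapezoid-≤-θ : ∀ m {τ σ} → τ ≤ σ → σ + τ ≤ 2 ^ m → trapezoid m τ ≤ (τ + τ) * θ m σ
  trapezoid-≤-θ zero {zero} τ≤σ le = z≤n
  trapezoid-≤-θ zero {suc τ} {suc σ} τ≤σ (s≤s le) with () ← subst (_≤ 0) (+-suc σ τ) le
  trapezoid-≤-θ (suc m) {τ} {σ} τ≤σ le with σ ≤? 2 ^ m
  ... | yes lo = trapezoid-≤-θ-low m (trapezoid-≤-θ m) τ≤σ lo
  ... | no hi with complement (m+n≤o⇒m≤o σ le)
  ... | σ′ , σσ′ = subst (λ x → trapezoid (suc m) τ ≤ (τ + τ) * x) (sym (θ-sym (suc m) {σ} σσ′))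
    (trapezoid-≤-θ-low m (trapezoid-≤-θ m)
      (+-cancelˡ-≤ σ τ σ′ (≤-trans le (≤-reflexive (sym σσ′))))
      (complement-≤ (2 ^ m) (trans σσ′ (2^suc m)) (<⇒≤ (≰⇒> hi))))

  θ-middle-half : ∀ m {s} → 2 ^ m ≤ 4 * s → 4 * s ≤ 3 * 2 ^ m → 2 ^ m ≤ 2 * θ m s
  θ-middle-half zero {suc s} _ le = contradiction le (<⇒≱ (s≤s (≤-trans (s≤s (s≤s (s≤s z≤n))) (≤-reflexive (sym (shape s))))))
    where
    shape : ∀ s → s + (suc s + (suc s + (suc s + 0))) ≡ 3 + 4 * s
    shape = solve-∀
  θ-middle-half (suc m) {s} lo hi = subst₂ _≤_ (sym (2^suc m)) (cong (θ (suc m) s +_) (sym (+-identityʳ _)))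
    (+-mono-≤ K≤θ K≤θ)
    where
    K = 2 ^ m
    K≤2s : K ≤ s + s
    K≤2s = half-≤ (≤-trans (≤-reflexive (sym (2^suc m))) (≤-trans lo (≤-reflexive (shape s))))
      where
      shape : ∀ s → 4 * s ≡ s + s + (s + s)
      shape = solve-∀
    2s≤3K : s + s ≤ K + K + K
    2s≤3K = half-≤ (≤-trans (≤-reflexive (sym (shape s))) (≤-trans hi (≤-reflexive (shape₂ K))))
      where
      shape : ∀ s → 4 * s ≡ s + s + (s + s)
      shape = solve-∀
      shape₂ : ∀ K → 3 * (K + (K + 0)) ≡ K + K + K + (K + K + K)
      shape₂ = solve-∀
    K≤θ : K ≤ θ (suc m) s
    K≤θ with s ≤? K
    ... | yes s≤ = θ-middle m s≤ K≤2s
    ... | no s≰ with complement {s} {2 ^ suc m} (half-≤ (≤-trans 2s≤3K (≤-trans (m≤m+n _ K) (≤-reflexive (shape K)))))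
      where
      shape : ∀ K → K + K + K + K ≡ K + (K + 0) + (K + (K + 0))
      shape = solve-∀
    ... | s′ , ss′ = subst (K ≤_) (sym (θ-sym (suc m) {s} ss′)) (θ-middle m
      (complement-≤ K (trans ss′ (2^suc m)) (<⇒≤ (≰⇒> s≰)))
      (≤-cancelling (s + s) (+-monoʳ-≤ K 2s≤3K) refl
        (trans (shape K) (trans (cong (λ x → x + x) (trans (sym (2^suc m)) (sym ss′))) (shape₂ s s′)))))
      where
      shape : ∀ K → K + (K + K + K) ≡ K + K + (K + K)
      shape = solve-∀
      shape₂ : ∀ s t → s + t + (s + t) ≡ t + t + (s + s)
      shape₂ = solve-∀

  -- Edge boundaries and Harper's inequality.

  apart : Bool → Bool → ℕ
  apart b c = bit (b xor c)

  apart-comm : ∀ b c → apart b c ≡ apart c b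
  apart-comm b c = cong bit (xor-comm b c)

  card : ∀ {n} → (Vec Bool n → Bool) → ℕ
  card A = ∑ (λ u → bit (A u))

  ∂ : ∀ {n} → (Vec Bool n → Bool) → ℕ
  ∂ A = edges apart A

  restrict : ∀ {n} → Fin (suc n) → Bool → (Vec Bool (suc n) → Bool) → Vec Bool n → Bool
  restrict i b A w = A (insertAt w i b)

  difference : ∀ {n} → (A B : Vec Bool n → Bool) → ℕ
  difference A B = ∑ (λ w → apart (A w) (B w))

  bit≤1 : ∀ b → bit b ≤ 1
  bit≤1 false = z≤n
  bit≤1 true  = ≤-refl

  card≤ : ∀ {n} (A : Vec Bool n → Bool) → card A ≤ 2 ^ n
  card≤ {n} A = ≤-trans (∑-mono (bit≤1 ∘ A)) (≤-reflexive (trans (∑-const n 1) (*-identityʳ (2 ^ n))))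

  card≤card+difference : ∀ {n} (A B : Vec Bool n → Bool) → card B ≤ card A + difference A B
  card≤card+difference A B = ≤-trans (∑-mono (λ u → pointwise (A u) (B u))) (≤-reflexive (∑-+ (bit ∘ A) (λ u → apart (A u) (B u))))
    where
    pointwise : ∀ b c → bit c ≤ bit b + apart b c
    pointwise false c     = ≤-refl
    pointwise true  false = z≤n
    pointwise true  true  = ≤-refl

  difference-comm : ∀ {n} (A B : Vec Bool n → Bool) → difference A B ≡ difference B A
  difference-comm A B = ∑-cong (λ u → apart-comm (A u) (B u))

  card≤card+difference′ : ∀ {n} (A B : Vec Bool n → Bool) → card A ≤ card B + difference A B
  card≤card+difference′ A B = subst (λ x → card A ≤ card B + x) (difference-comm B A) (card≤card+difference B A)

  -- Induction on the dimension: the edges between the facets number `difference A₀ A₁`, which is at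
  -- least the difference of the two sizes, and `θ-harper` absorbs them.
  harper : ∀ {n} (A : Vec Bool n → Bool) → θ n (card A) ≤ ∂ A
  harper {zero}  A = z≤n
  harper {suc n} A = ≤-trans
    (θ-harper n (card≤ A₀) (card≤ A₁) (card≤card+difference A₀ A₁) (card≤card+difference′ A₀ A₁))
    (+-monoˡ-≤ (difference A₀ A₁) (+-mono-≤ (harper A₀) (harper A₁)))
    where
    A₀ = λ w → A (false ∷ w)
    A₁ = λ w → A (true ∷ w)

  edges-insertAt : ∀ {n} {X : Set} (c : X → X → ℕ) (i : Fin (suc n)) (f : Vec Bool (suc n) → X) →
    edges c f ≡ edges c (λ w → f (insertAt w i false)) + edges c (λ w → f (insertAt w i true))
      + ∑ (λ w → c (f (insertAt w i false)) (f (insertAt w i true)))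
  edges-insertAt c zero f = refl
  edges-insertAt {suc n} c (suc i) f = trans
    (cong₂ _+_ (cong₂ _+_ (edges-insertAt c i (f ∘ (false ∷_))) (edges-insertAt c i (f ∘ (true ∷_))))
      (∑-insertAt i (λ w → c (f (false ∷ w)) (f (true ∷ w)))))
    (rearrange (edges c (λ w → f (false ∷ insertAt w i false))) (edges c (λ w → f (false ∷ insertAt w i true))) _
               (edges c (λ w → f (true ∷ insertAt w i false))) (edges c (λ w → f (true ∷ insertAt w i true))) _ _ _)
    where
    rearrange : ∀ a b c d e f g h → a + b + c + (d + e + f) + (g + h) ≡ (a + d + g) + (b + e + h) + (c + f)
    rearrange = solve-∀

  restrict-balanced : ∀ m i (A : Vec Bool (suc (suc m)) → Bool) → card A ≡ 2 ^ suc m →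
    card (restrict i false A) + card (restrict i true A) ≡ 2 ^ suc m
  restrict-balanced m i A bal = trans (sym (∑-insertAt i (bit ∘ A))) bal

  -- The two facets hold complementary sizes, hence have the same `θ (suc m)`, and at least
  -- `2 ^ suc m - 2f` edges run in direction `i`. The linear terms of the two `θ (suc m)` cancel the
  -- `2f`.
  ∂-fold : ∀ m i (A : Vec Bool (suc (suc m)) → Bool) → card A ≡ 2 ^ suc m →
    2 ^ suc m + 2 * θ m (fold m (card (restrict i false A))) ≤ ∂ A
  ∂-fold m i A bal = begin
    2 ^ suc m + 2 * θ m f                     ≤⟨ +-monoˡ-≤ (2 * θ m f) balance ⟩
    f + f + g + 2 * θ m f                     ≡⟨ shape f g (θ m f) ⟩
    θ (suc m) t + θ (suc m) t + g             ≡⟨ cong (λ x → θ (suc m) t + x + g) (θ-sym (suc m) {t} tt′) ⟩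
    θ (suc m) t + θ (suc m) t′ + g            ≤⟨ +-monoˡ-≤ g (+-mono-≤ (harper A₀) (harper A₁)) ⟩
    ∂ A₀ + ∂ A₁ + g                           ≡⟨ edges-insertAt apart i A ⟨
    ∂ A                                       ∎
    where
    open ≤-Reasoning
    A₀ = restrict i false A
    A₁ = restrict i true A
    t = card A₀
    t′ = card A₁
    f = fold m t
    g = difference A₀ A₁
    tt′ : t + t′ ≡ 2 ^ suc m
    tt′ = restrict-balanced m i A bal
    f≡ : f ≡ t ⊓ t′
    f≡ = cong (t ⊓_) (trans (cong (_∸ t) (sym tt′)) (m+n∸m≡n t t′))
    shape : ∀ f g x → f + f + g + 2 * x ≡ f + x + (f + x) + g
    shape = solve-∀
    balance : 2 ^ suc m ≤ f + f + g
    balance with ≤-total t t′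
    ... | inj₁ t≤t′ rewrite f≡ | m≤n⇒m⊓n≡m t≤t′ = begin
      2 ^ suc m    ≡⟨ tt′ ⟨
      t + t′       ≤⟨ +-monoʳ-≤ t (card≤card+difference A₀ A₁) ⟩
      t + (t + g)  ≡⟨ +-assoc t t g ⟨
      t + t + g    ∎
    ... | inj₂ t′≤t rewrite f≡ | m≥n⇒m⊓n≡n t′≤t = begin
      2 ^ suc m     ≡⟨ tt′ ⟨
      t + t′        ≤⟨ +-monoˡ-≤ t′ (card≤card+difference′ A₀ A₁) ⟩
      t′ + g + t′   ≡⟨ comm t′ g ⟩
      t′ + t′ + g   ∎
      where
      comm : ∀ t g → t + g + t ≡ t + t + g
      comm = solve-∀

-- Fourier analysis on the cube and the weight at level one.

module Spectral where

  open Isoperimetry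
  open import Data.Nat as ℕ using (ℕ; zero; suc; _^_)
  import Data.Nat.Properties as ℕ
  import Data.Nat.Tactic.RingSolver as ℕ
  open import Data.Integer as ℤ using (ℤ; +_; 0ℤ; _+_; _*_; _-_; _≤_; ∣_∣)
  import Data.Integer.Properties as ℤ
  open import Data.Integer.Tactic.RingSolver using (solve-∀)
  open import Algebra.Properties.CommutativeMonoid.Sum ℕ.+-0-commutativeMonoid using (sum; ∑-distrib-+)

  ∑ℤ : ∀ {n} → (Vec Bool n → ℤ) → ℤ
  ∑ℤ {zero}  F = F []
  ∑ℤ {suc n} F = ∑ℤ (λ w → F (false ∷ w)) + ∑ℤ (λ w → F (true ∷ w))

  square : ℤ → ℤ
  square x = x * x

  energy : ∀ {n} → (Vec Bool n → ℤ) → ℤ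
  energy {zero}  F = 0ℤ
  energy {suc n} F = energy (λ w → F (false ∷ w)) + energy (λ w → F (true ∷ w))
    + ∑ℤ (λ w → square (F (false ∷ w) - F (true ∷ w)))

  norm² : ∀ {n} → (Vec Bool n → ℤ) → ℤ
  norm² F = ∑ℤ (λ u → square (F u))

  _⊞_ _⊟_ : ∀ {n} → (Vec Bool n → ℤ) → (Vec Bool n → ℤ) → Vec Bool n → ℤ
  (F ⊞ G) u = F u + G u
  (F ⊟ G) u = F u - G u

  face : ∀ {n} → Bool → (Vec Bool (suc n) → ℤ) → Vec Bool n → ℤ
  face b F w = F (b ∷ w)

  -- The unnormalised Fourier coefficient of F at the singleton {i}.
  fourier₁ : ∀ {n} → Fin n → (Vec Bool n → ℤ) → ℤ
  fourier₁ zero    F = ∑ℤ (face false F) - ∑ℤ (face true F)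
  fourier₁ (suc i) F = fourier₁ i (face false F) + fourier₁ i (face true F)

  -- The sum of the squares of all `fourier₁ i F`: the coefficients at later coordinates are those
  -- of the sum of the two faces, by `fourier₁-⊞`. This recursive form is the one that the induction
  -- in `level-two` meets.
  weight₁ : ∀ {n} → (Vec Bool n → ℤ) → ℤ
  weight₁ {zero}  F = 0ℤ
  weight₁ {suc n} F = square (fourier₁ zero F) + weight₁ (face false F ⊞ face true F)

  ∑ℤ-⊞ : ∀ {n} (F G : Vec Bool n → ℤ) → ∑ℤ (F ⊞ G) ≡ ∑ℤ F + ∑ℤ G
  ∑ℤ-⊞ {zero}  F G = refl
  ∑ℤ-⊞ {suc n} F G = trans (cong₂ _+_ (∑ℤ-⊞ (face false F) (face false G)) (∑ℤ-⊞ (face true F) (face true G)))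
    (interchangeℤ (∑ℤ (face false F)) _ _ _)
    where
    interchangeℤ : ∀ a b c d → (a + b) + (c + d) ≡ (a + c) + (b + d)
    interchangeℤ = solve-∀

  ∑ℤ-⊟ : ∀ {n} (F G : Vec Bool n → ℤ) → ∑ℤ (F ⊟ G) ≡ ∑ℤ F - ∑ℤ G
  ∑ℤ-⊟ {zero}  F G = refl
  ∑ℤ-⊟ {suc n} F G = trans (cong₂ _+_ (∑ℤ-⊟ (face false F) (face false G)) (∑ℤ-⊟ (face true F) (face true G)))
    (interchangeℤ (∑ℤ (face false F)) _ _ _)
    where
    interchangeℤ : ∀ a b c d → (a - b) + (c - d) ≡ (a + c) - (b + d)
    interchangeℤ = solve-∀

  ∑ℤ-parallelogram : ∀ {n} {F G F′ G′ : Vec Bool n → ℤ} → (∀ u → F u + G u ≡ + 2 * (F′ u + G′ u)) →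
    ∑ℤ F + ∑ℤ G ≡ + 2 * (∑ℤ F′ + ∑ℤ G′)
  ∑ℤ-parallelogram {zero} eq = eq []
  ∑ℤ-parallelogram {suc n} {F} {G} {F′} {G′} eq = trans (lhs (∑ℤ (face false F)) _ _ _)
    (trans (cong₂ _+_ (∑ℤ-parallelogram (eq ∘ (false ∷_))) (∑ℤ-parallelogram (eq ∘ (true ∷_))))
           (rhs (∑ℤ (face false F′)) (∑ℤ (face false G′)) (∑ℤ (face true F′)) (∑ℤ (face true G′))))
    where
    lhs : ∀ a b c d → (a + b) + (c + d) ≡ (a + c) + (b + d)
    lhs = solve-∀
    rhs : ∀ a b c d → + 2 * (a + b) + + 2 * (c + d) ≡ + 2 * ((a + c) + (b + d))
    rhs = solve-∀

  norm²-parallelogram : ∀ {n} (F G : Vec Bool n → ℤ) → norm² (F ⊞ G) + norm² (F ⊟ G) ≡ + 2 * (norm² F + norm² G)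
  norm²-parallelogram F G = ∑ℤ-parallelogram (λ u → identity (F u) (G u))
    where
    identity : ∀ x y → (x + y) * (x + y) + (x - y) * (x - y) ≡ + 2 * (x * x + y * y)
    identity = solve-∀

  energy-parallelogram : ∀ {n} (F G : Vec Bool n → ℤ) → energy (F ⊞ G) + energy (F ⊟ G) ≡ + 2 * (energy F + energy G)
  energy-parallelogram {zero}  F G = refl
  energy-parallelogram {suc n} F G = trans (lhs (energy (face false F ⊞ face false G)) _ _ _ _ _)
    (trans (cong₂ _+_ (cong₂ _+_ (energy-parallelogram (face false F) (face false G)) (energy-parallelogram (face true F) (face true G)))
             (∑ℤ-parallelogram {F′ = λ w → square (F (false ∷ w) - F (true ∷ w))} {λ w → square (G (false ∷ w) - G (true ∷ w))}
               (λ w → identity (F (false ∷ w)) (F (true ∷ w)) (G (false ∷ w)) (G (true ∷ w)))))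
           (rhs (energy (face false F)) (energy (face false G)) (energy (face true F)) (energy (face true G)) _ _))
    where
    lhs : ∀ a b c d e f → (a + b + c) + (d + e + f) ≡ (a + d) + (b + e) + (c + f)
    lhs = solve-∀
    rhs : ∀ a b c d e f → + 2 * (a + b) + + 2 * (c + d) + + 2 * (e + f) ≡ + 2 * (a + c + e + (b + d + f))
    rhs = solve-∀
    identity : ∀ x y z w → (x + z - (y + w)) * (x + z - (y + w)) + (x - z - (y - w)) * (x - z - (y - w))
      ≡ + 2 * ((x - y) * (x - y) + (z - w) * (z - w))
    identity = solve-∀

  0≤square : ∀ x → 0ℤ ≤ square x
  0≤square (+ n)      = subst (0ℤ ≤_) (ℤ.pos-* n n) (ℤ.+≤+ ℕ.z≤n)
  0≤square (ℤ.-[1+ n ]) = ℤ.+≤+ ℕ.z≤n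

  0≤∑ℤ : ∀ {n} {F : Vec Bool n → ℤ} → (∀ u → 0ℤ ≤ F u) → 0ℤ ≤ ∑ℤ F
  0≤∑ℤ {zero}  0≤F = 0≤F []
  0≤∑ℤ {suc n} 0≤F = ℤ.+-mono-≤ (0≤∑ℤ (0≤F ∘ (false ∷_))) (0≤∑ℤ (0≤F ∘ (true ∷_)))

  0≤energy : ∀ {n} (F : Vec Bool n → ℤ) → 0ℤ ≤ energy F
  0≤energy {zero}  F = ℤ.≤-refl
  0≤energy {suc n} F = ℤ.+-mono-≤ (ℤ.+-mono-≤ (0≤energy (face false F)) (0≤energy (face true F)))
    (0≤∑ℤ (λ w → 0≤square (F (false ∷ w) - F (true ∷ w))))

  pos-2^suc : ∀ n → + (2 ^ suc n) ≡ + (2 ^ n) + + (2 ^ n)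
  pos-2^suc n = trans (cong +_ (2^suc n)) (ℤ.pos-+ (2 ^ n) (2 ^ n))

  -- With F^(S) the unnormalised Fourier coefficients, `2 ^ n * energy F` is twice the sum of |S|
  -- F^(S)² and `2 ^ n * norm² F` is the sum of F^(S)². The expression is therefore twice the sum of
  -- (|S| - 1) F^(S)² over nonempty S. The induction separates the sets S without the first
  -- coordinate, seen by `F₀ ⊞ F₁`, from those with it, seen by `F₀ ⊟ F₁`.
  poincare : ∀ {n} (F : Vec Bool n → ℤ) →
    0ℤ ≤ + (2 ^ n) * energy F + + 2 * square (∑ℤ F) - + 2 * + (2 ^ n) * norm² F
  poincare {zero} F = ℤ.≤-reflexive (sym (identity (F [])))
    where
    identity : ∀ x → + 1 * 0ℤ + + 2 * (x * x) - + 2 * + 1 * (x * x) ≡ 0ℤ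
    identity = solve-∀
  poincare {suc n} F = subst (0ℤ ≤_) eq
    -- Sets containing the first coordinate have |S| ≥ 1 already, so for `H` nonnegative energy is
    -- enough.
    (ℤ.+-mono-≤ (poincare G) (subst (_≤ P * energy H) (ℤ.*-zeroʳ P) (ℤ.*-monoˡ-≤-nonNeg P (0≤energy H))))
    where
    F₀ = face false F
    F₁ = face true F
    G = F₀ ⊞ F₁
    H = F₀ ⊟ F₁
    P = + (2 ^ n)
    -- The sums become variables, which leaves a polynomial identity modulo the two parallelogram
    -- laws.
    combine : ∀ {P P′ eG eH s s′ nG nH n e₀} → P′ ≡ P + P → s′ ≡ s → nG + nH ≡ + 2 * n → eG + eH ≡ + 2 * e₀ →
      P * eG + + 2 * (s′ * s′) - + 2 * P * nG + P * eH
      ≡ P′ * (e₀ + nH) + + 2 * (s * s) - + 2 * P′ * n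
    combine {P} {eG = eG} {eH} {s} {_} {nG} {nH} {n} {e₀} refl refl hn he = trans (step₁ P eG eH s nG nH)
      (trans (cong₂ (λ x y → P * y + (P + P) * nH + + 2 * (s * s) - + 2 * P * x) hn he) (step₂ P e₀ s nH n))
      where
      step₁ : ∀ P eG eH s nG nH → P * eG + + 2 * (s * s) - + 2 * P * nG + P * eH
        ≡ P * (eG + eH) + (P + P) * nH + + 2 * (s * s) - + 2 * P * (nG + nH)
      step₁ = solve-∀
      step₂ : ∀ P e₀ s nH n → P * (+ 2 * e₀) + (P + P) * nH + + 2 * (s * s) - + 2 * P * (+ 2 * n)
        ≡ (P + P) * (e₀ + nH) + + 2 * (s * s) - + 2 * (P + P) * n
      step₂ = solve-∀
    eq : P * energy G + + 2 * square (∑ℤ G) - + 2 * P * norm² G + P * energy H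
      ≡ + (2 ^ suc n) * energy F + + 2 * square (∑ℤ F) - + 2 * + (2 ^ suc n) * norm² F
    eq = combine {P} {+ (2 ^ suc n)} {energy G} {energy H} {∑ℤ F} {∑ℤ G} {norm² G} {norm² H} {norm² F} {energy F₀ + energy F₁}
      (pos-2^suc n) (∑ℤ-⊞ F₀ F₁) (norm²-parallelogram F₀ F₁) (energy-parallelogram F₀ F₁)

  -- Level inequality: spectral weight outside levels 0 and 1 counts at least twice in the energy.
  level-two : ∀ {n} (F : Vec Bool n → ℤ) →
    0ℤ ≤ + (2 ^ n) * energy F + + 2 * weight₁ F + + 4 * square (∑ℤ F) - + 4 * + (2 ^ n) * norm² F
  level-two {zero} F = ℤ.≤-reflexive (sym (identity (F [])))
    where
    identity : ∀ x → + 1 * 0ℤ + + 2 * 0ℤ + + 4 * (x * x) - + 4 * + 1 * (x * x) ≡ 0ℤ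
    identity = solve-∀
  level-two {suc n} F = subst (0ℤ ≤_) eq (ℤ.+-mono-≤ (level-two G) (poincare H))
    where
    F₀ = face false F
    F₁ = face true F
    G = F₀ ⊞ F₁
    H = F₀ ⊟ F₁
    P = + (2 ^ n)
    combine : ∀ {P P′ eG eH w s s′ h h′ nG nH n e₀} → P′ ≡ P + P → s′ ≡ s → h′ ≡ h → nG + nH ≡ + 2 * n → eG + eH ≡ + 2 * e₀ →
      P * eG + + 2 * w + + 4 * (s′ * s′) - + 4 * P * nG + (P * eH + + 2 * (h′ * h′) - + 2 * P * nH)
      ≡ P′ * (e₀ + nH) + + 2 * (h * h + w) + + 4 * (s * s) - + 4 * P′ * n
    combine {P} {eG = eG} {eH} {w} {s} {_} {h} {_} {nG} {nH} {n} {e₀} refl refl refl hn he = trans (step₁ P eG eH w s h nG nH)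
      (trans (cong₂ (λ x y → P * y + (P + P) * nH + + 2 * (h * h + w) + + 4 * (s * s) - + 4 * P * x) hn he)
             (step₂ P w s h nH n e₀))
      where
      step₁ : ∀ P eG eH w s h nG nH → P * eG + + 2 * w + + 4 * (s * s) - + 4 * P * nG + (P * eH + + 2 * (h * h) - + 2 * P * nH)
        ≡ P * (eG + eH) + (P + P) * nH + + 2 * (h * h + w) + + 4 * (s * s) - + 4 * P * (nG + nH)
      step₁ = solve-∀
      step₂ : ∀ P w s h nH n e₀ → P * (+ 2 * e₀) + (P + P) * nH + + 2 * (h * h + w) + + 4 * (s * s) - + 4 * P * (+ 2 * n)
        ≡ (P + P) * (e₀ + nH) + + 2 * (h * h + w) + + 4 * (s * s) - + 4 * (P + P) * n
      step₂ = solve-∀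
    eq : P * energy G + + 2 * weight₁ G + + 4 * square (∑ℤ G) - + 4 * P * norm² G + (P * energy H + + 2 * square (∑ℤ H) - + 2 * P * norm² H)
      ≡ + (2 ^ suc n) * energy F + + 2 * weight₁ F + + 4 * square (∑ℤ F) - + 4 * + (2 ^ suc n) * norm² F
    eq = combine {P} {+ (2 ^ suc n)} {energy G} {energy H} {weight₁ G} {∑ℤ F} {∑ℤ G} {fourier₁ zero F} {∑ℤ H}
      {norm² G} {norm² H} {norm² F} {energy F₀ + energy F₁}
      (pos-2^suc n) (∑ℤ-⊞ F₀ F₁) (∑ℤ-⊟ F₀ F₁) (norm²-parallelogram F₀ F₁) (energy-parallelogram F₀ F₁)

  fourier₁-⊞ : ∀ {n} i (F G : Vec Bool n → ℤ) → fourier₁ i (F ⊞ G) ≡ fourier₁ i F + fourier₁ i G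
  fourier₁-⊞ zero F G = trans (cong₂ _-_ (∑ℤ-⊞ (face false F) (face false G)) (∑ℤ-⊞ (face true F) (face true G)))
    (identity (∑ℤ (face false F)) (∑ℤ (face false G)) _ _)
    where
    identity : ∀ a b c d → (a + b) - (c + d) ≡ (a - c) + (b - d)
    identity = solve-∀
  fourier₁-⊞ (suc i) F G = trans (cong₂ _+_ (fourier₁-⊞ i (face false F) (face false G)) (fourier₁-⊞ i (face true F) (face true G)))
    (identity (fourier₁ i (face false F)) _ _ _)
    where
    identity : ∀ a b c d → (a + b) + (c + d) ≡ (a + c) + (b + d)
    identity = solve-∀

  square-abs : ∀ x → square x ≡ + (∣ x ∣ ℕ.* ∣ x ∣)
  square-abs (+ n)        = sym (ℤ.pos-* n n)
  square-abs (ℤ.-[1+ n ]) = refl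

  -- In `p * x²` one factor |x| is bounded by `q / p` uniformly and the other by `d i`, so that only
  -- the sum of the `d i` enters.
  weight₁-≤ : ∀ {n} (F : Vec Bool n → ℤ) (d : Fin n → ℕ) p q →
    (∀ i → ∣ fourier₁ i F ∣ ℕ.≤ d i) → (∀ i → p ℕ.* ∣ fourier₁ i F ∣ ℕ.≤ q) → + p * weight₁ F ≤ + (q ℕ.* sum d)
  weight₁-≤ {zero}  F d p q _ _ = ℤ.≤-trans (ℤ.≤-reflexive (ℤ.*-zeroʳ (+ p))) (ℤ.+≤+ ℕ.z≤n)
  weight₁-≤ {suc n} F d p q ≤d ≤q = begin
    + p * (square x + w)                       ≡⟨ ℤ.*-distribˡ-+ (+ p) (square x) w ⟩
    + p * square x + + p * w                   ≡⟨ cong (λ y → + p * y + + p * w) (square-abs x) ⟩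
    + p * + (∣ x ∣ ℕ.* ∣ x ∣) + + p * w         ≡⟨ cong (_+ + p * w) (ℤ.pos-* p _) ⟨
    + (p ℕ.* (∣ x ∣ ℕ.* ∣ x ∣)) + + p * w       ≤⟨ ℤ.+-mono-≤
        (ℤ.+≤+ (subst (ℕ._≤ q ℕ.* d zero) (ℕ.*-assoc p ∣ x ∣ ∣ x ∣) (ℕ.*-mono-≤ (≤q zero) (≤d zero))))
        (weight₁-≤ (face false F ⊞ face true F) (d ∘ suc) p q
          (λ i → subst (λ y → ∣ y ∣ ℕ.≤ d (suc i)) (sym (fourier₁-⊞ i (face false F) (face true F))) (≤d (suc i)))
          (λ i → subst (λ y → p ℕ.* ∣ y ∣ ℕ.≤ q) (sym (fourier₁-⊞ i (face false F) (face true F))) (≤q (suc i)))) ⟩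
    + (q ℕ.* d zero) + + (q ℕ.* sum (d ∘ suc))   ≡⟨ ℤ.pos-+ (q ℕ.* d zero) _ ⟨
    + (q ℕ.* d zero ℕ.+ q ℕ.* sum (d ∘ suc))     ≡⟨ cong +_ (ℕ.*-distribˡ-+ q (d zero) _) ⟨
    + (q ℕ.* sum d)                            ∎
    where
    open ℤ.≤-Reasoning
    x = fourier₁ zero F
    w = weight₁ (face false F ⊞ face true F)

  indicator : ∀ {n} → (Vec Bool n → Bool) → Vec Bool n → ℤ
  indicator A u = + bit (A u)

  ∑ℤ-pos : ∀ {n} {F : Vec Bool n → ℤ} {f : Vec Bool n → ℕ} → (∀ u → F u ≡ + f u) → ∑ℤ F ≡ + ∑ f
  ∑ℤ-pos {zero} eq = eq []
  ∑ℤ-pos {suc n} eq = cong₂ _+_ (∑ℤ-pos (eq ∘ (false ∷_))) (∑ℤ-pos (eq ∘ (true ∷_)))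

  norm²-indicator : ∀ {n} (A : Vec Bool n → Bool) → norm² (indicator A) ≡ + card A
  norm²-indicator A = ∑ℤ-pos (λ u → pointwise (A u))
    where
    pointwise : ∀ b → square (+ bit b) ≡ + bit b
    pointwise false = refl
    pointwise true  = refl

  energy-indicator : ∀ {n} (A : Vec Bool n → Bool) → energy (indicator A) ≡ + ∂ A
  energy-indicator {zero}  A = refl
  energy-indicator {suc n} A =
    cong₂ _+_ (cong₂ _+_ (energy-indicator (A ∘ (false ∷_))) (energy-indicator (A ∘ (true ∷_))))
      (∑ℤ-pos (λ w → pointwise (A (false ∷ w)) (A (true ∷ w))))
    where
    pointwise : ∀ b c → square (+ bit b - + bit c) ≡ + apart b c
    pointwise false false = refl
    pointwise false true  = refl
    pointwise true  false = refl
    pointwise true  true  = refl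

  influence : ∀ {n} → Fin n → (Vec Bool n → Bool) → ℕ
  influence zero    A = difference (A ∘ (false ∷_)) (A ∘ (true ∷_))
  influence (suc i) A = influence i (A ∘ (false ∷_)) ℕ.+ influence i (A ∘ (true ∷_))

  ∂≡sum-influence : ∀ {n} (A : Vec Bool n → Bool) → ∂ A ≡ sum (λ i → influence i A)
  ∂≡sum-influence {zero}  A = refl
  ∂≡sum-influence {suc n} A = trans (ℕ.+-comm (∂ (A ∘ (false ∷_)) ℕ.+ ∂ (A ∘ (true ∷_))) (influence zero A))
    (cong (influence zero A ℕ.+_) (trans
      (cong₂ ℕ._+_ (∂≡sum-influence (A ∘ (false ∷_))) (∂≡sum-influence (A ∘ (true ∷_))))
      (sym (∑-distrib-+ (λ i → influence i (A ∘ (false ∷_))) (λ i → influence i (A ∘ (true ∷_)))))))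

  abs-difference : ∀ t t′ → (t ≡ t′ ℕ.+ ∣ + t - + t′ ∣) ⊎ (t′ ≡ t ℕ.+ ∣ + t - + t′ ∣)
  abs-difference t t′ with ℕ.≤-total t t′
  ... | inj₁ t≤t′ = inj₂ (sym (trans (cong (t ℕ.+_) (trans (cong ∣_∣ (ℤ.m-n≡m⊖n t t′)) (ℤ.∣⊖∣-≤ t≤t′))) (ℕ.m+[n∸m]≡n t≤t′)))
  ... | inj₂ t′≤t = inj₁ (sym (trans (cong (t′ ℕ.+_) (trans (cong ∣_∣ (ℤ.m-n≡m⊖n t t′)) (trans (ℤ.∣m⊖n∣≡∣n⊖m∣ t t′) (ℤ.∣⊖∣-≤ t′≤t)))) (ℕ.m+[n∸m]≡n t′≤t)))

  fourier₁-indicator : ∀ {n} i (A : Vec Bool (suc n) → Bool) →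
    fourier₁ i (indicator A) ≡ + card (restrict i false A) - + card (restrict i true A)
  fourier₁-indicator zero A = cong₂ _-_ (∑ℤ-pos {F = face false (indicator A)} (λ _ → refl)) (∑ℤ-pos {F = face true (indicator A)} (λ _ → refl))
  fourier₁-indicator {suc n} (suc i) A = trans
    (cong₂ _+_ (fourier₁-indicator i (A ∘ (false ∷_))) (fourier₁-indicator i (A ∘ (true ∷_))))
    (trans (identity (+ a) (+ b) (+ c) (+ d)) (sym (cong₂ _-_ (ℤ.pos-+ a c) (ℤ.pos-+ b d))))
    where
    a = card (restrict i false (A ∘ (false ∷_)))
    b = card (restrict i true (A ∘ (false ∷_)))
    c = card (restrict i false (A ∘ (true ∷_)))
    d = card (restrict i true (A ∘ (true ∷_)))
    identity : ∀ a b c d → (a - b) + (c - d) ≡ (a + c) - (b + d)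
    identity = solve-∀

  ∣fourier₁∣≤influence : ∀ {n} i (A : Vec Bool n → Bool) → ∣ fourier₁ i (indicator A) ∣ ℕ.≤ influence i A
  ∣fourier₁∣≤influence zero A = subst (λ x → ∣ x ∣ ℕ.≤ influence zero A) (sym (fourier₁-indicator zero A)) bound
    where
    A₀ = A ∘ (false ∷_)
    A₁ = A ∘ (true ∷_)
    bound : ∣ + card A₀ - + card A₁ ∣ ℕ.≤ difference A₀ A₁
    bound with abs-difference (card A₀) (card A₁)
    ... | inj₁ eq = ℕ.+-cancelˡ-≤ (card A₁) _ _ (subst (ℕ._≤ card A₁ ℕ.+ difference A₀ A₁) eq (card≤card+difference′ A₀ A₁))
    ... | inj₂ eq = ℕ.+-cancelˡ-≤ (card A₀) _ _ (subst (ℕ._≤ card A₀ ℕ.+ difference A₀ A₁) eq (card≤card+difference A₀ A₁))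
  ∣fourier₁∣≤influence (suc i) A = ℕ.≤-trans
    (ℤ.∣i+j∣≤∣i∣+∣j∣ (fourier₁ i (indicator (A ∘ (false ∷_)))) (fourier₁ i (indicator (A ∘ (true ∷_)))))
    (ℕ.+-mono-≤ (∣fourier₁∣≤influence i (A ∘ (false ∷_))) (∣fourier₁∣≤influence i (A ∘ (true ∷_))))

  near-balanced : ∀ {M s s′ d} → s ≡ s′ ℕ.+ d → s ℕ.+ s′ ≡ M ℕ.+ M → 3 ℕ.* M ℕ.≤ 4 ℕ.* s′ → 2 ℕ.* d ℕ.≤ M
  near-balanced {M} {_} {s′} {d} refl eq le = ≤-cancelling (3 ℕ.* M) (ℕ.+-monoʳ-≤ (2 ℕ.* d) le) refl
    (trans (shape d s′) (trans (cong (2 ℕ.*_) eq) (shape₂ M)))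
    where
    shape : ∀ d s → 2 ℕ.* d ℕ.+ 4 ℕ.* s ≡ 2 ℕ.* (s ℕ.+ d ℕ.+ s)
    shape = ℕ.solve-∀
    shape₂ : ∀ M → 2 ℕ.* (M ℕ.+ M) ≡ M ℕ.+ 3 ℕ.* M
    shape₂ = ℕ.solve-∀

  -- Near balance makes each level-one coefficient at most `M / 2`; each is also at most the
  -- influence of its coordinate, so twice the weight is at most `M * ∂ A`. With `N = 4M` and
  -- `H = 2M`, `level-two` then reads 32 M² ≤ 5 M ∂A + 16 M², and 16/5 exceeds 3.
  ∂-far : ∀ m (A : Vec Bool (suc (suc m)) → Bool) → card A ≡ 2 ^ suc m →
    (∀ i → 3 ℕ.* 2 ^ m ℕ.≤ 4 ℕ.* fold m (card (restrict i false A))) → 3 ℕ.* 2 ^ m ℕ.≤ ∂ A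
  ∂-far m A bal far = ℕ.*-cancelˡ-≤ 5 (ℕ.≤-trans (≤-cancelling 0 (ℕ.m≤m+n (15 ℕ.* M) M) (shape₀ M) (shape₁ M)) 16M≤5∂)
    where
    M = 2 ^ m
    N = 2 ^ suc (suc m)
    H = 2 ^ suc m
    small : ∀ i → 2 ℕ.* ∣ fourier₁ i (indicator A) ∣ ℕ.≤ M
    small i rewrite fourier₁-indicator i A = go (abs-difference t t′)
      where
      t = card (restrict i false A)
      t′ = card (restrict i true A)
      tt′ : t ℕ.+ t′ ≡ M ℕ.+ M
      tt′ = trans (restrict-balanced m i A bal) (2^suc m)
      fold≤t′ : fold m t ℕ.≤ t′
      fold≤t′ = ℕ.≤-trans (ℕ.m⊓n≤n t _) (ℕ.≤-reflexive (trans (cong (ℕ._∸ t) (sym (restrict-balanced m i A bal))) (ℕ.m+n∸m≡n t t′)))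
      go : (t ≡ t′ ℕ.+ ∣ + t - + t′ ∣) ⊎ (t′ ≡ t ℕ.+ ∣ + t - + t′ ∣) → 2 ℕ.* ∣ + t - + t′ ∣ ℕ.≤ M
      go (inj₁ eq) = near-balanced eq tt′ (ℕ.≤-trans (far i) (ℕ.*-monoʳ-≤ 4 fold≤t′))
      go (inj₂ eq) = near-balanced eq (trans (ℕ.+-comm t′ t) tt′) (ℕ.≤-trans (far i) (ℕ.*-monoʳ-≤ 4 (ℕ.m⊓n≤m t _)))
    weight≤ : + 2 * weight₁ (indicator A) ≤ + (M ℕ.* ∂ A)
    weight≤ = subst (λ x → + 2 * weight₁ (indicator A) ≤ + (M ℕ.* x)) (sym (∂≡sum-influence A))
      (weight₁-≤ (indicator A) (λ i → influence i A) 2 M (λ i → ∣fourier₁∣≤influence i A) small)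
    integral : + (4 ℕ.* N ℕ.* H) ≤ + (N ℕ.* ∂ A ℕ.+ M ℕ.* ∂ A ℕ.+ 4 ℕ.* (H ℕ.* H))
    integral = begin
      + (4 ℕ.* N ℕ.* H)
        ≡⟨ trans (ℤ.pos-* (4 ℕ.* N) H) (cong (_* + H) (ℤ.pos-* 4 N)) ⟩
      + 4 * + N * + H
        ≡⟨ cong (+ 4 * + N *_) (trans (norm²-indicator A) (cong +_ bal)) ⟨
      + 4 * + N * norm² (indicator A)
        ≤⟨ ℤ.0≤i-j⇒j≤i (level-two (indicator A)) ⟩
      + N * energy (indicator A) + + 2 * weight₁ (indicator A) + + 4 * square (∑ℤ (indicator A))
        ≤⟨ ℤ.+-monoˡ-≤ (+ 4 * square (∑ℤ (indicator A))) (ℤ.+-monoʳ-≤ (+ N * energy (indicator A)) weight≤) ⟩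
      + N * energy (indicator A) + + (M ℕ.* ∂ A) + + 4 * square (∑ℤ (indicator A))
        ≡⟨ cong₂ _+_ (cong (_+ + (M ℕ.* ∂ A)) (trans (cong (+ N *_) (energy-indicator A)) (sym (ℤ.pos-* N (∂ A)))))
             (trans (cong (λ x → + 4 * square x) (trans (∑ℤ-pos {F = indicator A} (λ _ → refl)) (cong +_ bal)))
               (trans (cong (+ 4 *_) (sym (ℤ.pos-* H H))) (sym (ℤ.pos-* 4 (H ℕ.* H))))) ⟩
      + (N ℕ.* ∂ A) + + (M ℕ.* ∂ A) + + (4 ℕ.* (H ℕ.* H))
        ≡⟨ trans (ℤ.pos-+ (N ℕ.* ∂ A ℕ.+ M ℕ.* ∂ A) _) (cong (_+ + (4 ℕ.* (H ℕ.* H))) (ℤ.pos-+ (N ℕ.* ∂ A) _)) ⟨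
      + (N ℕ.* ∂ A ℕ.+ M ℕ.* ∂ A ℕ.+ 4 ℕ.* (H ℕ.* H)) ∎
      where open ℤ.≤-Reasoning
    instance
      M≢0 : ℕ.NonZero M
      M≢0 = ℕ.m^n≢0 2 m
    16M≤5∂ : 16 ℕ.* M ℕ.≤ 5 ℕ.* ∂ A
    16M≤5∂ = ℕ.*-cancelˡ-≤ M (≤-cancelling (16 ℕ.* (M ℕ.* M)) (ℤ.drop‿+≤+ integral) (shape₂ M) (shape₃ M (∂ A)))
      where
      shape₂ : ∀ M → M ℕ.* (16 ℕ.* M) ℕ.+ 16 ℕ.* (M ℕ.* M) ≡ 4 ℕ.* (2 ℕ.* (2 ℕ.* M)) ℕ.* (2 ℕ.* M)
      shape₂ = ℕ.solve-∀
      shape₃ : ∀ M x → 2 ℕ.* (2 ℕ.* M) ℕ.* x ℕ.+ M ℕ.* x ℕ.+ 4 ℕ.* ((2 ℕ.* M) ℕ.* (2 ℕ.* M)) ≡ M ℕ.* (5 ℕ.* x) ℕ.+ 16 ℕ.* (M ℕ.* M)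
      shape₃ = ℕ.solve-∀
    shape₀ : ∀ M → 5 ℕ.* (3 ℕ.* M) ℕ.+ 0 ≡ 15 ℕ.* M
    shape₀ = ℕ.solve-∀
    shape₁ : ∀ M → 15 ℕ.* M ℕ.+ M ≡ 16 ℕ.* M ℕ.+ 0
    shape₁ = ℕ.solve-∀

open Isoperimetry
open Spectral using (∂-far)
open import Data.Nat
open import Data.Nat.Properties
open import Data.Nat.Tactic.RingSolver using (solve-∀)

-- Walks on the levels and what they cost.

∑< : ℕ → (ℕ → ℕ) → ℕ
∑< zero    f = 0
∑< (suc k) f = ∑< k f + f k

∑<-mono : ∀ L {f g} → (∀ {k} → k < L → f k ≤ g k) → ∑< L f ≤ ∑< L g
∑<-mono zero    le = z≤n
∑<-mono (suc L) le = +-mono-≤ (∑<-mono L (λ k<L → le (m<n⇒m<1+n k<L))) (le ≤-refl)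

∑<-cong : ∀ L {f g} → (∀ {k} → k < L → f k ≡ g k) → ∑< L f ≡ ∑< L g
∑<-cong zero    eq = refl
∑<-cong (suc L) eq = cong₂ _+_ (∑<-cong L (λ k<L → eq (m<n⇒m<1+n k<L))) (eq ≤-refl)

∑<-+ : ∀ L f g → ∑< L (λ k → f k + g k) ≡ ∑< L f + ∑< L g
∑<-+ zero    f g = refl
∑<-+ (suc L) f g = trans (cong (_+ (f L + g L)) (∑<-+ L f g)) (interchange (∑< L f) _ _ _)

∑<-const : ∀ L c → ∑< L (λ _ → c) ≡ L * c
∑<-const zero    c = refl
∑<-const (suc L) c = trans (cong (_+ c) (∑<-const L c)) (+-comm (L * c) c)

∑<-monoˡ : ∀ f {a b} → a ≤ b → ∑< a f ≤ ∑< b f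
∑<-monoˡ f {zero} a≤b = z≤n
∑<-monoˡ f {suc a} {suc b} (s≤s a≤b) with m≤n⇒m<n∨m≡n a≤b
... | inj₁ a<b  = ≤-trans (∑<-monoˡ f a<b) (m≤m+n _ (f b))
... | inj₂ refl = ≤-refl

-- A walk rising by at most one per step skips no level on its way up, so it pays `ψ` for each level
-- between its start and its end. A descent only shrinks the sum on the left, `ψ` being nonnegative.
climb : ∀ (t ψ e : ℕ → ℕ) k₀ L → (∀ {k} → k < k₀ + L → t (suc k) ≤ suc (t k)) → (∀ {k} → k < k₀ + L → ψ (t k) ≤ e k) →
  ∑< (t (k₀ + L)) ψ + ∑< k₀ e ≤ ∑< (t k₀) ψ + ∑< (k₀ + L) e
climb t ψ e k₀ zero up le rewrite +-identityʳ k₀ = ≤-refl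
climb t ψ e k₀ (suc L) up le rewrite +-suc k₀ L = begin
  ∑< (t (suc (k₀ + L))) ψ + ∑< k₀ e                 ≤⟨ +-monoˡ-≤ (∑< k₀ e) (∑<-monoˡ ψ (up ≤-refl)) ⟩
  ∑< (t (k₀ + L)) ψ + ψ (t (k₀ + L)) + ∑< k₀ e      ≡⟨ swap (∑< (t (k₀ + L)) ψ) _ _ ⟩
  ∑< (t (k₀ + L)) ψ + ∑< k₀ e + ψ (t (k₀ + L))      ≤⟨ +-mono-≤
    (climb t ψ e k₀ L (λ k< → up (m<n⇒m<1+n k<)) (λ k< → le (m<n⇒m<1+n k<))) (le ≤-refl) ⟩
  ∑< (t k₀) ψ + ∑< (k₀ + L) e + e (k₀ + L)          ≡⟨ +-assoc (∑< (t k₀) ψ) _ _ ⟩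
  ∑< (t k₀) ψ + (∑< (k₀ + L) e + e (k₀ + L))        ∎
  where
  open ≤-Reasoning
  swap : ∀ a b c → a + b + c ≡ a + c + b
  swap = solve-∀

∑<-∸ : ∀ Φ c a d → ∑< (a + d) Φ + ∑< a (λ s → Φ s ∸ c) ≤ ∑< a Φ + ∑< (a + d) (λ s → Φ s ∸ c) + d * c
∑<-∸ Φ c a zero rewrite +-identityʳ a | +-identityʳ (∑< a Φ + ∑< a (λ s → Φ s ∸ c)) = ≤-refl
∑<-∸ Φ c a (suc d) rewrite +-suc a d =
  ≤-cancelling 0 (+-mono-≤ (∑<-∸ Φ c a d) (m≤n+m∸n (Φ (a + d)) c))
    (lhs (∑< (a + d) Φ) (∑< a (λ s → Φ s ∸ c)) (Φ (a + d))) (rhs (∑< a Φ) (∑< (a + d) (λ s → Φ s ∸ c)) (d * c) c (Φ (a + d) ∸ c))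
  where
  lhs : ∀ x y z → x + z + y + 0 ≡ x + y + z
  lhs = solve-∀
  rhs : ∀ x y z c w → x + y + z + (c + w) ≡ x + (y + w) + (c + z) + 0
  rhs = solve-∀

-- A closed walk meets every level between t k₀ and t′ k₀; each of the remaining steps still costs c.
module Sweep
  {H c : ℕ} {t t′ X Φ : ℕ → ℕ}
  (tt′ : ∀ {k} → k ≤ H → t k + t′ k ≡ H) (closed : t H ≡ t′ 0)
  (up : ∀ {k} → k < H → t (suc k) ≤ suc (t k)) (up′ : ∀ {k} → k < H → t′ (suc k) ≤ suc (t′ k))
  (Φ≤X : ∀ {k} → k < H → Φ (t k) ≤ X k) (Φ≤X′ : ∀ {k} → k < H → Φ (t′ k) ≤ X k)
  (c≤X : ∀ {k} → k < H → c ≤ X k) where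

  -- Excess over a base price `c` paid at every step. The truncation is harmless: a level with `Φ`
  -- below `c` is already paid for by the base price.
  ψ e : ℕ → ℕ
  ψ s = Φ s ∸ c
  e k = X k ∸ c

  excess : ∀ {k₀} → k₀ ≤ H → ∑< (t′ k₀) ψ ≤ ∑< (t k₀) ψ + ∑< H e
  excess {k₀} k₀≤H with complement k₀≤H
  ... | L , refl = ≤-cancelling (∑< (t (k₀ + L)) ψ + ∑< k₀ e)
    -- The walk follows `t` from `k₀` to `H` and continues along `t′` from `0` to `k₀`; `closed`
    -- joins the two pieces, which together use every step once.
    (+-mono-≤ (climb t ψ e k₀ L up (λ k< → ∸-monoˡ-≤ c (Φ≤X k<)))
              (climb t′ ψ e 0 k₀ (λ k< → up′ (≤-trans k< k₀≤H)) (λ k< → ∸-monoˡ-≤ c (Φ≤X′ (≤-trans k< k₀≤H)))))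
    (lhs (∑< (t′ k₀) ψ) (∑< (t (k₀ + L)) ψ) (∑< k₀ e))
    (cong (λ x → ∑< (t k₀) ψ + ∑< (k₀ + L) e + (∑< x ψ + ∑< k₀ e)) (sym closed))
    where
    lhs : ∀ x y z → x + (y + z) ≡ y + z + (x + 0)
    lhs = solve-∀

  sweep : ∀ {k₀} → k₀ ≤ H → t k₀ ≤ t′ k₀ →
    ∑< (t′ k₀) Φ + (t k₀ + t k₀) * c ≤ ∑< (t k₀) Φ + ∑< H X
  sweep {k₀} k₀≤H τ≤τ′ with complement τ≤τ′
  ... | d , τd = ≤-cancelling (∑< (t k₀) ψ + ∑< (t′ k₀) ψ)
    (+-mono-≤ (+-mono-≤ (subst (λ x → ∑< x Φ + ∑< (t k₀) ψ ≤ ∑< (t k₀) Φ + ∑< x ψ + d * c) τd (∑<-∸ Φ c (t k₀) d)) (excess k₀≤H))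
      (≤-refl {(t k₀ + t k₀) * c}))
    (lhs (∑< (t′ k₀) Φ) _ _ _)
    (trans (rhs (∑< (t k₀) Φ) (∑< (t′ k₀) ψ) (∑< (t k₀) ψ) (∑< H e) (t k₀) d c)
      (cong (λ x → ∑< (t k₀) Φ + x + (∑< (t k₀) ψ + ∑< (t′ k₀) ψ)) total))
    where
    lhs : ∀ x y z w → x + y + (z + w) ≡ x + z + w + y
    lhs = solve-∀
    rhs : ∀ x y z w τ d c → x + y + d * c + (z + w) + (τ + τ) * c ≡ x + (w + (τ + (τ + d)) * c) + (z + y)
    rhs = solve-∀
    -- Of the `H` base prices, `d` go to the levels met and `t k₀ + t k₀` remain as surplus.
    total : ∑< H e + (t k₀ + (t k₀ + d)) * c ≡ ∑< H X
    total = begin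
      ∑< H e + (t k₀ + (t k₀ + d)) * c     ≡⟨ cong (λ x → ∑< H e + x * c) (trans (cong (t k₀ +_) τd) (tt′ k₀≤H)) ⟩
      ∑< H e + H * c                       ≡⟨ cong (∑< H e +_) (∑<-const H c) ⟨
      ∑< H e + ∑< H (λ _ → c)              ≡⟨ ∑<-+ H e (λ _ → c) ⟨
      ∑< H (λ k → X k ∸ c + c)             ≡⟨ ∑<-cong H (λ k< → m∸n+n≡m (c≤X k<)) ⟩
      ∑< H X                               ∎
      where open ≡-Reasoning

-- The missing levels, and lower bounds for the boundary of a balanced set.

∑<-trapezoid : ∀ m τ → ∑< τ (θ m) + ∑< (suc τ) (θ m) ≡ trapezoid m τ
∑<-trapezoid m zero    = θ-zero m
∑<-trapezoid m (suc τ) = trans (identity (∑< τ (θ m)) (θ m τ) (θ m (suc τ)))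
  (cong (_+ (θ m τ + θ m (suc τ))) (∑<-trapezoid m τ))
  where
  identity : ∀ s x y → s + x + (s + x + y) ≡ s + (s + x) + (x + y)
  identity = solve-∀

-- The `y` levels from `2 ^ m` on fold to `2 ^ m` down to `suc τ`. Together with [0 , τ] they make
-- one pass over [0 , 2 ^ m], besides the pass made by the levels below `2 ^ m`.
∑<-fold : ∀ m y τ → y + τ ≡ 2 ^ m → ∑< (2 ^ m + y) (θ m ∘ fold m) + ∑< (suc τ) (θ m) ≡ trapezoid m (2 ^ m)
∑<-fold m zero .(2 ^ m) refl =
  trans (cong (_+ ∑< (suc (2 ^ m)) (θ m)) (trans (cong (λ x → ∑< x (θ m ∘ fold m)) (+-identityʳ (2 ^ m)))
    (∑<-cong (2 ^ m) (λ k< → cong (θ m) (fold-low m (<⇒≤ k<)))))) (∑<-trapezoid m (2 ^ m))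
∑<-fold m (suc y) τ eq rewrite +-suc (2 ^ m) y = trans
  (cong (λ x → ∑< (2 ^ m + y) (θ m ∘ fold m) + θ m x + ∑< (suc τ) (θ m)) (fold-high m reflect (m+n≤o⇒n≤o y (≤-reflexive eq′))))
  (trans (identity (∑< (2 ^ m + y) (θ m ∘ fold m)) (θ m (suc τ)) (∑< (suc τ) (θ m))) (∑<-fold m y (suc τ) eq′))
  where
  eq′ : y + suc τ ≡ 2 ^ m
  eq′ = trans (+-suc y τ) eq
  reflect : 2 ^ m + y + suc τ ≡ 2 ^ suc m
  reflect = trans (+-assoc (2 ^ m) y (suc τ)) (trans (cong (2 ^ m +_) eq′) (sym (2^suc m)))
  identity : ∀ a b c → a + b + c ≡ a + (c + b)
  identity = solve-∀

module _ m (A : Vec Bool (suc (suc m)) → Bool) (bal : card A ≡ 2 ^ suc m)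
  {τ} (τ≤ : ∀ i → τ ≤ fold m (card (restrict i false A))) where

  private
    M = 2 ^ m
    f : Fin (suc (suc m)) → ℕ
    f i = fold m (card (restrict i false A))

  -- At the threshold 3/4 both methods work: above it in all coordinates `∂-far` applies; below it
  -- in some coordinate, `∂-fold` there is strong enough by `θ-middle-half` or `trapezoid-≤-θ`.
  far-or-near : (3 * M ≤ ∂ A) ⊎ (∃ λ i → 4 * f i ≤ 3 * M)
  far-or-near with any? (λ i → 4 * f i ≤? 3 * M)
  ... | yes near = inj₂ near
  ... | no  far  = inj₁ (∂-far m A bal (λ i → <⇒≤ (≰⇒> (λ le → far (i , le)))))

  ∂-≥-middle : M ≤ 4 * τ → 3 * M ≤ ∂ A
  ∂-≥-middle M≤4τ with far-or-near
  ... | inj₁ le = le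
  ... | inj₂ (i , near) = begin
    3 * M                    ≡⟨ +-comm M (2 * M) ⟩
    2 ^ suc m + M            ≤⟨ +-monoʳ-≤ (2 ^ suc m) (θ-middle-half m (≤-trans M≤4τ (*-monoʳ-≤ 4 (τ≤ i))) near) ⟩
    2 ^ suc m + 2 * θ m (f i) ≤⟨ ∂-fold m i A bal ⟩
    ∂ A                      ∎
    where open ≤-Reasoning

  -- This is what a surplus step must pay: `2 ^ suc m + trapezoid m τ / τ` is the mean cost of the
  -- `2τ` missing levels. The form multiplied by `τ` includes `τ = 0`.
  ∂-≥-trapezoid : 4 * τ ≤ M → trapezoid m τ + τ * 2 ^ suc m ≤ τ * ∂ A
  ∂-≥-trapezoid 4τ≤M with far-or-near
  ... | inj₁ le = begin
    trapezoid m τ + τ * 2 ^ suc m    ≤⟨ +-monoˡ-≤ (τ * 2 ^ suc m) (trapezoid-≤ m {τ} τ+τ≤M) ⟩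
    τ * M + τ * 2 ^ suc m            ≡⟨ *-distribˡ-+ τ M (2 ^ suc m) ⟨
    τ * (3 * M)                      ≤⟨ *-monoʳ-≤ τ le ⟩
    τ * ∂ A                          ∎
    where
    open ≤-Reasoning
    τ+τ≤M : τ + τ ≤ M
    τ+τ≤M = m+n≤o⇒m≤o (τ + τ) (≤-trans (≤-reflexive (shape τ)) 4τ≤M)
      where
      shape : ∀ t → t + t + (t + t) ≡ 4 * t
      shape = solve-∀
  ... | inj₂ (i , near) = begin
    trapezoid m τ + τ * 2 ^ suc m          ≤⟨ +-monoˡ-≤ (τ * 2 ^ suc m) (trapezoid-≤-θ m (τ≤ i) f+τ≤M) ⟩
    (τ + τ) * θ m (f i) + τ * 2 ^ suc m    ≡⟨ shape τ (θ m (f i)) (2 ^ suc m) ⟩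
    τ * (2 ^ suc m + 2 * θ m (f i))        ≤⟨ *-monoʳ-≤ τ (∂-fold m i A bal) ⟩
    τ * ∂ A                                ∎
    where
    open ≤-Reasoning
    shape : ∀ t x y → (t + t) * x + t * y ≡ t * (y + 2 * x)
    shape = solve-∀
    -- The thresholds 3/4 for `f i` and 1/4 for `τ` add up to one.
    f+τ≤M : f i + τ ≤ M
    f+τ≤M = *-cancelˡ-≤ 4 (≤-trans (≤-reflexive (*-distribˡ-+ 4 (f i) τ)) (≤-trans (+-mono-≤ near 4τ≤M) (≤-reflexive (+-comm (3 * M) M))))

-- Distance on the cycle and antipodal cuts.

δ : ℕ → ℕ → ℕ
δ k x = bit (k ≡ᵇ x)

δ-refl : ∀ k → δ k k ≡ 1
δ-refl zero    = refl
δ-refl (suc k) = δ-refl k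

δ-off : ∀ {k x} → k ≢ x → δ k x ≡ 0
δ-off {zero}  {zero}  k≢x = contradiction refl k≢x
δ-off {zero}  {suc x} k≢x = refl
δ-off {suc k} {zero}  k≢x = refl
δ-off {suc k} {suc x} k≢x = δ-off (k≢x ∘ cong suc)

∑<-δ-beyond : ∀ L {x} → L ≤ x → ∑< L (λ k → δ k x) ≡ 0
∑<-δ-beyond zero    L≤x = refl
∑<-δ-beyond (suc L) L<x = cong₂ _+_ (∑<-δ-beyond L (<⇒≤ L<x)) (δ-off (<⇒≢ L<x))

∑<-δ≤1 : ∀ L x → ∑< L (λ k → δ k x) ≤ 1
∑<-δ≤1 zero x = z≤n
∑<-δ≤1 (suc L) x with L ≟ x
... | yes refl rewrite ∑<-δ-beyond L ≤-refl | δ-refl L = ≤-refl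
... | no  L≢x  rewrite δ-off L≢x | +-identityʳ (∑< L (λ k → δ k x)) = ∑<-δ≤1 L x

∑<-split : ∀ a b f → ∑< (a + b) f ≡ ∑< a f + ∑< b (λ k → f (k + a))
∑<-split a zero    f rewrite +-identityʳ a | +-identityʳ (∑< a f) = refl
∑<-split a (suc b) f rewrite +-suc a b | ∑<-split a b f | +-comm b a = +-assoc (∑< a f) _ _

<ᵇ-true : ∀ {x k} → x < k → (x <ᵇ k) ≡ true
<ᵇ-true {zero}  {suc k} _ = refl
<ᵇ-true {suc x} {suc k} (s≤s x<k) = <ᵇ-true x<k

<ᵇ-false : ∀ {x k} → k ≤ x → (x <ᵇ k) ≡ false
<ᵇ-false {x}     {zero}  _ = refl
<ᵇ-false {suc x} {suc k} (s≤s k≤x) = <ᵇ-false k≤x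

apart-<ᵇ : ∀ k x → apart (x <ᵇ k) (suc x <ᵇ k) ≡ δ k (suc x)
apart-<ᵇ zero          x       = refl
apart-<ᵇ (suc zero)    zero    = refl
apart-<ᵇ (suc (suc k)) zero    = refl
apart-<ᵇ (suc k)       (suc x) = apart-<ᵇ k x

bit-<ᵇ-suc : ∀ k x → bit (x <ᵇ suc k) ≡ bit (x <ᵇ k) + δ k x
bit-<ᵇ-suc zero    zero    = refl
bit-<ᵇ-suc zero    (suc x) = refl
bit-<ᵇ-suc (suc k) zero    = refl
bit-<ᵇ-suc (suc k) (suc x) = bit-<ᵇ-suc k x

apart-self : ∀ b → apart b b ≡ 0
apart-self false = refl
apart-self true  = refl

apart-triangle : ∀ a b c → apart a c ≤ apart a b + apart b c
apart-triangle false false c     = ≤-refl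
apart-triangle false true  c     = ≤-trans (bit≤1 c) (m≤m+n 1 _)
apart-triangle true  true  c     = ≤-refl
apart-triangle true  false c     = ≤-trans (bit≤1 (not c)) (m≤m+n 1 _)

apart-xor : ∀ a b c d → apart (a xor b) (c xor d) ≤ apart a c + apart b d
apart-xor false b     false d     = ≤-refl
apart-xor true  true  true  true  = z≤n
apart-xor true  true  true  false = ≤-refl
apart-xor true  false true  true  = ≤-refl
apart-xor true  false true  false = z≤n
apart-xor false b     true  d     = ≤-trans (bit≤1 (b xor not d)) (m≤m+n 1 _)
apart-xor true  b     false d     = ≤-trans (bit≤1 (not b xor d)) (m≤m+n 1 _)

-- For k ≤ H, membership of x in the half-circle [k , k + H) of the cycle on [0 , 2H).
arc : ℕ → ℕ → ℕ → Bool
arc H k x = (x <ᵇ k) xor (x <ᵇ k + H)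

separation : ℕ → ℕ → ℕ → ℕ
separation H a b = ∑< H (λ k → apart (arc H k a) (arc H k b))

separation-triangle : ∀ H a b c → separation H a c ≤ separation H a b + separation H b c
separation-triangle H a b c = ≤-trans
  (∑<-mono H (λ {k} _ → apart-triangle (arc H k a) (arc H k b) (arc H k c)))
  (≤-reflexive (∑<-+ H _ _))

separation-comm : ∀ H a b → separation H a b ≡ separation H b a
separation-comm H a b = ∑<-cong H (λ {k} _ → apart-comm (arc H k a) (arc H k b))

separation-self : ∀ H a → separation H a a ≡ 0
separation-self H a = trans (∑<-cong H (λ {k} _ → apart-self (arc H k a))) (trans (∑<-const H 0) (*-zeroʳ H))

-- Between `x` and `suc x` only the threshold `suc x` is crossed. The thresholds `k` and `k + H` of
-- the arcs with `k < H` run through [0 , 2H) once, so at most one arc is affected.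
separation-suc : ∀ H x → separation H x (suc x) ≤ 1
separation-suc H x = begin
  separation H x (suc x)
    ≤⟨ ∑<-mono H (λ {k} _ → ≤-trans (apart-xor (x <ᵇ k) (x <ᵇ k + H) (suc x <ᵇ k) (suc x <ᵇ k + H))
         (≤-reflexive (cong₂ _+_ (apart-<ᵇ k x) (apart-<ᵇ (k + H) x)))) ⟩
  ∑< H (λ k → δ k (suc x) + δ (k + H) (suc x))
    ≡⟨ ∑<-+ H _ _ ⟩
  ∑< H (λ k → δ k (suc x)) + ∑< H (λ k → δ (k + H) (suc x))
    ≡⟨ ∑<-split H H (λ k → δ k (suc x)) ⟨
  ∑< (H + H) (λ k → δ k (suc x))
    ≤⟨ ∑<-δ≤1 (H + H) (suc x) ⟩
  1 ∎
  where open ≤-Reasoning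

separation-+ : ∀ H x d → separation H x (x + d) ≤ d
separation-+ H x zero rewrite +-identityʳ x = ≤-reflexive (separation-self H x)
separation-+ H x (suc d) rewrite +-suc x d = ≤-trans (separation-triangle H x (x + d) (suc (x + d)))
  (≤-trans (+-mono-≤ (separation-+ H x d) (separation-suc H (x + d))) (≤-reflexive (+-comm d 1)))

-- The last point `2H - 1` and the first point `0` are separated by the arc [0 , H) alone.
separation-ends : ∀ h → separation (suc h) 0 (h + suc h) ≤ 1
separation-ends h = ≤-trans (∑<-mono (suc h) (λ {k} k< → ≤-reflexive (pointwise k k<))) (∑<-δ≤1 (suc h) 0)
  where
  first : ∀ k → arc (suc h) k 0 ≡ (k ≡ᵇ 0)
  first zero    = refl
  first (suc k) = refl
  last : ∀ k → k < suc h → arc (suc h) k (h + suc h) ≡ false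
  last k (s≤s k≤h) = cong₂ _xor_ (<ᵇ-false (≤-trans k≤h (m≤m+n h _))) (<ᵇ-false (+-monoˡ-≤ (suc h) k≤h))
  pointwise : ∀ k → k < suc h → apart (arc (suc h) k 0) (arc (suc h) k (h + suc h)) ≡ δ k 0
  pointwise k k< = trans (cong₂ apart (first k) (last k k<)) (cong bit (xor-identityʳ (k ≡ᵇ 0)))

-- The way round through the seam: `a` steps from `a` down to `0`, one across, and `r - 1` from
-- `2H - 1` down to `a + d`; in all `a + r`, which is `2H - d`.
separation-around : ∀ H a d {r} → a + d + r ≡ H + H → 0 < r → separation H a (a + d) ≤ H + H ∸ d
separation-around zero    a d eq 0<r = z≤n
separation-around (suc h) a d {suc r} eq 0<r = begin
  separation (suc h) a (a + d)
    ≤⟨ ≤-trans (separation-triangle (suc h) a 0 (a + d)) (+-monoʳ-≤ (separation (suc h) a 0) (separation-triangle (suc h) 0 (h + suc h) (a + d))) ⟩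
  separation (suc h) a 0 + (separation (suc h) 0 (h + suc h) + separation (suc h) (h + suc h) (a + d))
    ≤⟨ +-mono-≤ (≤-trans (≤-reflexive (separation-comm (suc h) a 0)) (separation-+ (suc h) 0 a))
         (+-mono-≤ (separation-ends h)
           (≤-trans (≤-reflexive (trans (separation-comm (suc h) (h + suc h) (a + d)) (cong (separation (suc h) (a + d)) (sym end)))) (separation-+ (suc h) (a + d) r))) ⟩
  a + suc r
    ≡⟨ m+n∸n≡m (a + suc r) d ⟨
  a + suc r + d ∸ d
    ≡⟨ cong (_∸ d) (trans (swap a (suc r) d) eq) ⟩
  suc h + suc h ∸ d ∎
  where
  open ≤-Reasoning
  end : a + d + r ≡ h + suc h
  end = suc-injective (trans (sym (+-suc (a + d) r)) eq)
  swap : ∀ a r d → a + r + d ≡ a + d + r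
  swap = solve-∀

separation≤cycDist-ordered : ∀ H {a b} → a ≤ b → b < H + H → separation H a b ≤ (b ∸ a) ⊓ (H + H ∸ (b ∸ a))
separation≤cycDist-ordered H {a} {b} a≤b b< with complement a≤b | complement (<⇒≤ b<)
... | d , refl | r , eq rewrite m+n∸m≡n a d = ⊓-glb (separation-+ H a d)
  (separation-around H a d eq (+-cancelˡ-< (a + d) 0 r (subst₂ _<_ (sym (+-identityʳ (a + d))) (sym eq) b<)))

separation≤cycDist : ∀ H {a b} → a < H + H → b < H + H → separation H a b ≤ cycDist (H + H) (suc a) (suc b)
separation≤cycDist H {a} {b} a< b< with ≤-total a b
... | inj₁ a≤b rewrite m≤n⇒∣m-n∣≡n∸m a≤b = separation≤cycDist-ordered H a≤b b<
... | inj₂ b≤a rewrite m≤n⇒∣n-m∣≡n∸m b≤a | separation-comm H a b = separation≤cycDist-ordered H b≤a a<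

arc-bit : ∀ H k x → bit (arc H k x) + bit (x <ᵇ k) ≡ bit (x <ᵇ k + H)
arc-bit H k x with <-≤-connex x k
... | inj₁ x<k rewrite <ᵇ-true x<k | <ᵇ-true (≤-trans x<k (m≤m+n k H)) = refl
... | inj₂ k≤x rewrite <ᵇ-false k≤x = +-identityʳ _

arc-suc : ∀ H k x → bit (arc H (suc k) x) + δ k x ≡ bit (arc H k x) + δ (k + H) x
arc-suc H k x = +-cancelʳ-≡ (bit (x <ᵇ k)) _ _ (begin
  bit (arc H (suc k) x) + δ k x + bit (x <ᵇ k)    ≡⟨ swap (bit (arc H (suc k) x)) (δ k x) _ ⟩
  bit (arc H (suc k) x) + (bit (x <ᵇ k) + δ k x)  ≡⟨ cong (bit (arc H (suc k) x) +_) (bit-<ᵇ-suc k x) ⟨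
  bit (arc H (suc k) x) + bit (x <ᵇ suc k)        ≡⟨ arc-bit H (suc k) x ⟩
  bit (x <ᵇ suc (k + H))                          ≡⟨ bit-<ᵇ-suc (k + H) x ⟩
  bit (x <ᵇ k + H) + δ (k + H) x                  ≡⟨ cong (_+ δ (k + H) x) (arc-bit H k x) ⟨
  bit (arc H k x) + bit (x <ᵇ k) + δ (k + H) x    ≡⟨ swap₂ (bit (arc H k x)) (bit (x <ᵇ k)) _ ⟩
  bit (arc H k x) + δ (k + H) x + bit (x <ᵇ k)    ∎)
  where
  open ≡-Reasoning
  swap : ∀ a b c → a + b + c ≡ a + (c + b)
  swap = solve-∀
  swap₂ : ∀ a b c → a + b + c ≡ a + c + b
  swap₂ = solve-∀

arc-opposite : ∀ H {x} → x < H + H → bit (arc H 0 x) + bit (arc H H x) ≡ 1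
arc-opposite H {x} x< rewrite <ᵇ-true x< with x <ᵇ H
... | false = refl
... | true  = refl

-- Minimisers and interchange of finite sums.

argmin : ∀ (g : ℕ → ℕ) L → 0 < L → ∃ λ k → k < L × (∀ {j} → j < L → g k ≤ g j)
argmin g (suc zero) _ = 0 , s≤s z≤n , λ { {zero} _ → ≤-refl ; {suc j} (s≤s ()) }
argmin g (suc (suc L)) _ with argmin g (suc L) (s≤s z≤n)
... | k , k< , min with ≤-total (g k) (g (suc L))
... | inj₁ le = k , m<n⇒m<1+n k< , λ {j} j< → [ min , (λ { refl → le }) ]′ (m<1+n⇒m<n∨m≡n j<)
... | inj₂ ge = suc L , ≤-refl , λ {j} j< → [ (λ j<L → ≤-trans ge (min j<L)) , (λ { refl → ≤-refl }) ]′ (m<1+n⇒m<n∨m≡n j<)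

argminFin : ∀ {n} (g : Fin (suc n) → ℕ) → ∃ λ i → ∀ j → g i ≤ g j
argminFin {zero} g = zero , λ { zero → ≤-refl }
argminFin {suc n} g with argminFin (g ∘ suc)
... | i , min with ≤-total (g zero) (g (suc i))
... | inj₁ le = zero , λ { zero → ≤-refl ; (suc j) → ≤-trans le (min j) }
... | inj₂ ge = suc i , λ { zero → ge ; (suc j) → min j }

edges-zero : ∀ {n} {X : Set} (f : Vec Bool n → X) → edges (λ _ _ → 0) f ≡ 0
edges-zero {zero}  f = refl
edges-zero {suc n} f = cong₂ _+_ (cong₂ _+_ (edges-zero (f ∘ (false ∷_))) (edges-zero (f ∘ (true ∷_)))) (∑-zero {n} (λ _ → refl))

∑<-edges : ∀ {n} {X : Set} L (c : ℕ → X → X → ℕ) (f : Vec Bool n → X) →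
  ∑< L (λ k → edges (c k) f) ≡ edges (λ x y → ∑< L (λ k → c k x y)) f
∑<-edges zero    c f = sym (edges-zero f)
∑<-edges (suc L) c f = trans (cong (_+ edges (c L) f) (∑<-edges L c f)) (sym (edges-+ (λ x y → ∑< L (λ k → c k x y)) (c L) f))

-- The lower bound for an arbitrary layout.

module Layout m (p : Vec Bool (suc (suc m)) → ℕ)
  (p< : ∀ u → p u < 2 ^ suc (suc m)) (p-injective : ∀ {u v} → p u ≡ p v → u ≡ v)
  (p-surjective : ∀ {k} → k < 2 ^ suc (suc m) → ∃ λ u → p u ≡ k) where

  M H : ℕ
  M = 2 ^ m
  H = 2 ^ suc m

  p<H+H : ∀ u → p u < H + H
  p<H+H u = subst (p u <_) (2^suc (suc m)) (p< u)

  ∑-δ : ∀ {k} → k < H + H → ∑ (λ u → δ k (p u)) ≡ 1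
  ∑-δ {k} k< with p-surjective (subst (k <_) (sym (2^suc (suc m))) k<)
  ... | u , refl = trans (∑-single _ u (λ v v≢u → δ-off (λ eq → v≢u (sym (p-injective eq))))) (δ-refl (p u))

  ∑-<ᵇ : ∀ k → k ≤ H + H → ∑ (λ u → bit (p u <ᵇ k)) ≡ k
  ∑-<ᵇ zero    _  = ∑-zero {f = λ u → bit (p u <ᵇ 0)} (λ _ → refl)
  ∑-<ᵇ (suc k) k< = trans (∑-cong (λ u → bit-<ᵇ-suc k (p u)))
    (trans (∑-+ (λ u → bit (p u <ᵇ k)) (λ u → δ k (p u)))
      (trans (cong₂ _+_ (∑-<ᵇ k (<⇒≤ k<)) (∑-δ k<)) (+-comm k 1)))

  A : ℕ → Vec Bool (suc (suc m)) → Bool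
  A k u = arc H k (p u)

  A-balanced : ∀ {k} → k ≤ H → card (A k) ≡ H
  A-balanced {k} k≤H = +-cancelʳ-≡ k _ _ (begin
    card (A k) + k                                 ≡⟨ cong (card (A k) +_) (∑-<ᵇ k (≤-trans k≤H (m≤m+n H H))) ⟨
    card (A k) + ∑ (λ u → bit (p u <ᵇ k))          ≡⟨ ∑-+ (λ u → bit (A k u)) (λ u → bit (p u <ᵇ k)) ⟨
    ∑ (λ u → bit (A k u) + bit (p u <ᵇ k))         ≡⟨ ∑-cong (λ u → arc-bit H k (p u)) ⟩
    ∑ (λ u → bit (p u <ᵇ k + H))                   ≡⟨ ∑-<ᵇ (k + H) (+-monoˡ-≤ H k≤H) ⟩
    k + H                                          ≡⟨ +-comm k H ⟩
    H + k                                          ∎)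
    where open ≡-Reasoning

  level : Fin (suc (suc m)) → Bool → ℕ → ℕ
  level i b k = card (restrict i b (A k))

  level-sum : ∀ i b {k} → k ≤ H → level i b k + level i (not b) k ≡ H
  level-sum i false {k} k≤H = restrict-balanced m i (A k) (A-balanced k≤H)
  level-sum i true  {k} k≤H = trans (+-comm (level i true k) (level i false k)) (level-sum i false k≤H)

  ∑-δ-restrict : ∀ i b {k} → k < H + H → ∑ (λ w → δ k (p (insertAt w i b))) ≤ 1
  ∑-δ-restrict i b {k} k< = ≤-trans (half b) (≤-reflexive (trans (sym (∑-insertAt i (λ u → δ k (p u)))) (∑-δ k<)))
    where
    half : ∀ b → ∑ (λ w → δ k (p (insertAt w i b))) ≤ ∑ (λ w → δ k (p (insertAt w i false))) + ∑ (λ w → δ k (p (insertAt w i true)))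
    half false = m≤m+n _ _
    half true  = m≤n+m _ (∑ (λ w → δ k (p (insertAt w i false))))

  -- Only the vertex at position `k + H` enters the arc, and a vertex that leaves can only lower the
  -- level.
  level-up : ∀ i b {k} → k < H → level i b (suc k) ≤ suc (level i b k)
  level-up i b {k} k<H = begin
    level i b (suc k)                                           ≤⟨ m≤m+n _ _ ⟩
    level i b (suc k) + ∑ (λ w → δ k (p (insertAt w i b)))      ≡⟨ ∑-+ (λ w → bit (A (suc k) (insertAt w i b))) (λ w → δ k (p (insertAt w i b))) ⟨
    ∑ (λ w → bit (A (suc k) (insertAt w i b)) + δ k (p (insertAt w i b)))
                                                                ≡⟨ ∑-cong (λ w → arc-suc H k (p (insertAt w i b))) ⟩
    ∑ (λ w → bit (A k (insertAt w i b)) + δ (k + H) (p (insertAt w i b)))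
                                                                ≡⟨ ∑-+ (λ w → bit (A k (insertAt w i b))) (λ w → δ (k + H) (p (insertAt w i b))) ⟩
    level i b k + ∑ (λ w → δ (k + H) (p (insertAt w i b)))      ≤⟨ +-monoʳ-≤ (level i b k) (∑-δ-restrict i b (+-monoˡ-< H k<H)) ⟩
    level i b k + 1                                             ≡⟨ +-comm (level i b k) 1 ⟩
    suc (level i b k)                                           ∎
    where open ≤-Reasoning

  level-opposite : ∀ i b → level i b 0 + level i b H ≡ H
  level-opposite i b = trans (sym (∑-+ (λ w → bit (A 0 (insertAt w i b))) (λ w → bit (A H (insertAt w i b)))))
    (trans (∑-cong (λ w → arc-opposite H (p<H+H (insertAt w i b)))) (trans (∑-const (suc m) 1) (*-identityʳ H)))

  -- After `H` steps the arc has become its complement. Since the arc and the facet both have `H`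
  -- vertices, complementing the arc inside a facet and passing to the other facet give the same
  -- count.
  level-closed : ∀ i b → level i b H ≡ level i (not b) 0
  level-closed i b = +-cancelˡ-≡ (level i b 0) _ _ (trans (level-opposite i b) (sym (level-sum i b z≤n)))

  Φ : ℕ → ℕ
  Φ s = 2 ^ suc m + 2 * θ m (fold m s)

  X : ℕ → ℕ
  X k = ∂ (A k)

  Φ≤X : ∀ i b {k} → k < H → Φ (level i b k) ≤ X k
  Φ≤X i false {k} k< = ∂-fold m i (A k) (A-balanced (<⇒≤ k<))
  Φ≤X i true  {k} k< = subst (λ x → 2 ^ suc m + 2 * θ m x ≤ X k) (fold-sym m (level-sum i false (<⇒≤ k<))) (Φ≤X i false k<)

  ∑<-Φ : ∀ L → ∑< L Φ ≡ L * H + 2 * ∑< L (θ m ∘ fold m)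
  ∑<-Φ L = trans (∑<-+ L (λ _ → H) (λ s → 2 * θ m (fold m s))) (cong₂ _+_ (∑<-const L H) (scale L))
    where
    scale : ∀ L → ∑< L (λ s → 2 * θ m (fold m s)) ≡ 2 * ∑< L (θ m ∘ fold m)
    scale zero    = refl
    scale (suc L) = trans (cong (_+ 2 * θ m (fold m L)) (scale L)) (sym (*-distribˡ-+ 2 (∑< L (θ m ∘ fold m)) _))

  -- The `2τ` surplus steps at price `c` pay for the missing levels, which restores the sum of `Φ`
  -- over all of [0 , H). By `trapezoid-total` that sum is H² + 2 (M² - M) = 6 M² - H.
  swept : ∀ {τ τ′ c} → τ + τ′ ≡ H → τ ≤ τ′ → trapezoid m τ + τ * H ≤ τ * c →
    ∑< τ′ Φ + (τ + τ) * c ≤ ∑< τ Φ + ∑< H X → 6 * (M * M) ≤ ∑< H X + H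
  swept {τ} {τ′} {c} ττ′ τ≤τ′ τc swp with complement {τ} {M} (half-≤ (≤-trans (+-monoʳ-≤ τ τ≤τ′) (≤-reflexive (trans ττ′ (2^suc m)))))
  ... | y , τy = ≤-cancelling (τ * H + 2 * S + 2 * (τ * c))
    (+-mono-≤ (+-mono-≤ swp (*-monoʳ-≤ 2 τc)) (≤-refl {H}))
    lhs rhs
    where
    S = ∑< τ (θ m)
    T = trapezoid m τ
    S′ = ∑< τ′ (θ m ∘ fold m)
    -- The swept levels end `y` beyond the midpoint `M`, symmetrically to their start at `M - y`.
    τ′≡ : τ′ ≡ M + y
    τ′≡ = +-cancelˡ-≡ τ _ _ (trans ττ′ (trans (2^suc m) (trans (cong (M +_) (sym τy)) (shape M τ y))))
      where
      shape : ∀ M t y → M + (t + y) ≡ t + (M + y)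
      shape = solve-∀
    total : S′ + (S + θ m τ) + M ≡ M * M
    total rewrite τ′≡ = trans (cong (_+ M) (∑<-fold m y τ (trans (+-comm y τ) τy))) (trapezoid-total m)
    T≡ : S + (S + θ m τ) ≡ T
    T≡ = ∑<-trapezoid m τ
    Φτ : ∑< τ Φ ≡ τ * H + 2 * S
    Φτ = trans (∑<-Φ τ) (cong (λ x → τ * H + 2 * x) (∑<-cong τ (λ k< → cong (θ m) (fold-low m (<⇒≤ (≤-trans k< (m+n≤o⇒m≤o τ (≤-reflexive τy))))))))
    lhs : 6 * (M * M) + (τ * H + 2 * S + 2 * (τ * c)) ≡ ∑< τ′ Φ + (τ + τ) * c + 2 * (T + τ * H) + H
    lhs = begin
      6 * (M * M) + (τ * H + 2 * S + 2 * (τ * c))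
        ≡⟨ shape₁ M (τ * H) S τ c ⟩
      (M + M) * (M + M) + 2 * (M * M) + τ * H + 2 * S + (τ + τ) * c
        ≡⟨ cong₂ (λ x y → x + 2 * y + τ * H + 2 * S + (τ + τ) * c)
             (trans (cong₂ _*_ (trans (sym (2^suc m)) (sym ττ′)) (sym (2^suc m))) (*-distribʳ-+ H τ τ′)) (sym total) ⟩
      (τ * H + τ′ * H) + 2 * (S′ + (S + θ m τ) + M) + τ * H + 2 * S + (τ + τ) * c
        ≡⟨ shape₂ (τ * H) (τ′ * H) S′ S (θ m τ) M τ c ⟩
      (τ′ * H + 2 * S′) + (τ + τ) * c + 2 * (S + (S + θ m τ) + τ * H) + 2 * M
        ≡⟨ cong₂ (λ x y → x + (τ + τ) * c + 2 * (y + τ * H) + H) (sym (∑<-Φ τ′)) T≡ ⟩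
      ∑< τ′ Φ + (τ + τ) * c + 2 * (T + τ * H) + H ∎
      where
      open ≡-Reasoning
      shape₁ : ∀ M a S τ c → 6 * (M * M) + (a + 2 * S + 2 * (τ * c)) ≡ (M + M) * (M + M) + 2 * (M * M) + a + 2 * S + (τ + τ) * c
      shape₁ = solve-∀
      shape₂ : ∀ a b S′ S x M τ c → (a + b) + 2 * (S′ + (S + x) + M) + a + 2 * S + (τ + τ) * c
        ≡ (b + 2 * S′) + (τ + τ) * c + 2 * (S + (S + x) + a) + 2 * M
      shape₂ = solve-∀
    rhs : ∑< τ Φ + ∑< H X + 2 * (τ * c) + H ≡ ∑< H X + H + (τ * H + 2 * S + 2 * (τ * c))
    rhs = trans (cong (λ x → x + ∑< H X + 2 * (τ * c) + H) Φτ) (shape (τ * H + 2 * S) (∑< H X) (2 * (τ * c)) H)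
      where
      shape : ∀ a b c d → a + b + c + d ≡ b + d + (a + c)
      shape = solve-∀

  0<H : 0 < H
  0<H = m^n>0 2 (suc m)

  distance : Fin (suc (suc m)) → ℕ → ℕ
  distance i k = fold m (level i false k)

  distance≡ : ∀ i {k} → k ≤ H → distance i k ≡ level i false k ⊓ level i true k
  distance≡ i {k} k≤H = cong (level i false k ⊓_)
    (trans (cong (_∸ level i false k) (sym (level-sum i false k≤H))) (m+n∸m≡n (level i false k) (level i true k)))

  narrow : ∀ i b {k c} → k ≤ H → level i b k ≤ level i (not b) k → (∀ {j} → j < H → c ≤ X j) →
    trapezoid m (level i b k) + level i b k * H ≤ level i b k * c → 6 * (M * M) ≤ ∑< H X + H
  narrow i b {c = c} k≤H le c≤X cheap = swept (level-sum i b k≤H) le cheap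
    (Sweep.sweep {t = level i b} {level i (not b)} {X} {Φ} (level-sum i b) (level-closed i b)
      (level-up i b) (level-up i (not b)) (Φ≤X i b) (Φ≤X i (not b)) c≤X k≤H le)

  -- When every arc stays at distance at least `M / 4` from all facets, each of the `H = 2M`
  -- boundaries reaches the average `3M` by itself.
  wide : ∀ {τ} → (∀ i {k} → k < H → τ ≤ distance i k) → M ≤ 4 * τ → 6 * (M * M) ≤ ∑< H X + H
  wide τ≤ M≤4τ = begin
    6 * (M * M)             ≡⟨ shape M ⟩
    H * (3 * M)             ≡⟨ ∑<-const H (3 * M) ⟨
    ∑< H (λ _ → 3 * M)      ≤⟨ ∑<-mono H (λ {k} k< → ∂-≥-middle m (A k) (A-balanced (<⇒≤ k<)) (λ i → τ≤ i k<) M≤4τ) ⟩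
    ∑< H X                  ≤⟨ m≤m+n _ H ⟩
    ∑< H X + H              ∎
    where
    open ≤-Reasoning
    shape : ∀ M → 6 * (M * M) ≡ (2 * M) * (3 * M)
    shape = solve-∀

  -- The sweep starts at the arc and the facet that are closest. The price `c` is the least boundary
  -- `X k*`: the distance at the start also bounds the distances of `A k*` from below, so
  -- `∂-≥-trapezoid` applies to `A k*`.
  from-closest : ∀ i {k} → k < H → (∀ j {l} → l < H → distance i k ≤ distance j l) → 6 * (M * M) ≤ ∑< H X + H
  from-closest i {k} k< closest = [ near , wide closest ]′ (≤-total (4 * distance i k) M)
    where
    k≤H = <⇒≤ k<
    near : 4 * distance i k ≤ M → 6 * (M * M) ≤ ∑< H X + H
    near 4τ≤M = [ (λ le → narrow i false k≤H le c≤X (cheap (trans (distance≡ i k≤H) (m≤n⇒m⊓n≡m le))))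
                , (λ ge → narrow i true  k≤H ge c≤X (cheap (trans (distance≡ i k≤H) (m≥n⇒m⊓n≡n ge)))) ]′
                (≤-total (level i false k) (level i true k))
      where
      cheapest : ∃ λ k → k < H × (∀ {j} → j < H → X k ≤ X j)
      cheapest = argmin X H 0<H
      k* = proj₁ cheapest
      k*< = proj₁ (proj₂ cheapest)
      c≤X : ∀ {j} → j < H → X k* ≤ X j
      c≤X = proj₂ (proj₂ cheapest)
      cheap : ∀ {τ} → distance i k ≡ τ → trapezoid m τ + τ * H ≤ τ * X k*
      cheap eq = subst (λ τ → trapezoid m τ + τ * H ≤ τ * X k*) eq
        (∂-≥-trapezoid m (A k*) (A-balanced (<⇒≤ k*<)) (λ j → closest j k*<) 4τ≤M)

  ∑-∂-≥ : 6 * (M * M) ≤ ∑< H X + H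
  ∑-∂-≥ = from-closest (nearest k₀) (proj₁ (proj₂ first))
    (λ j {l} l< → ≤-trans (proj₂ (proj₂ first) l<) (proj₂ (argminFin (λ i → distance i l)) j))
    where
    nearest : ℕ → Fin (suc (suc m))
    nearest k = proj₁ (argminFin (λ i → distance i k))
    first : ∃ λ k → k < H × (∀ {j} → j < H → distance (nearest k) k ≤ distance (nearest j) j)
    first = argmin (λ k → distance (nearest k) k) H 0<H
    k₀ = proj₁ first

  -- Summed over `k`, an edge is counted once for every arc that separates its ends, which is at
  -- most its length on the cycle.
  ∑-∂-≤ : ∑< H X ≤ edges (cycDist (2 ^ suc (suc m))) (λ u → suc (p u))
  ∑-∂-≤ = begin
    ∑< H X
      -- The set `A k` is the arc composed with `p`; the arc moves from the labelling into the cost.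
      ≤⟨ ∑<-mono H (λ {k} _ → edges-mono {c = apart} {λ x y → apart (arc H k x) (arc H k y)} {A k} {p} (λ u v → ≤-refl)) ⟩
    ∑< H (λ k → edges (λ x y → apart (arc H k x) (arc H k y)) p)
      ≡⟨ ∑<-edges H (λ k x y → apart (arc H k x) (arc H k y)) p ⟩
    edges (separation H) p
      ≤⟨ edges-mono {c = separation H} {cycDist (2 ^ suc (suc m))} {p} {λ u → suc (p u)}
           (λ u v → subst (λ N → separation H (p u) (p v) ≤ cycDist N (suc (p u)) (suc (p v))) (sym (2^suc (suc m)))
             (separation≤cycDist H (p<H+H u) (p<H+H v))) ⟩
    edges (cycDist (2 ^ suc (suc m))) (λ u → suc (p u)) ∎
    where open ≤-Reasoning

  wirelength-≥ : 6 * (M * M) ≤ edges (cycDist (2 ^ suc (suc m))) (λ u → suc (p u)) + H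
  wirelength-≥ = ≤-trans ∑-∂-≥ (+-monoˡ-≤ H ∑-∂-≤)

-- The Gray code as a bijection.

gray : ∀ {n} → Vec Bool n → ℕ
gray x = binVal 0 (prefixXor false x)

binVal-acc : ∀ {n} acc (ys : Vec Bool n) → binVal acc ys ≡ 2 ^ n * acc + binVal 0 ys
binVal-acc acc [] = sym (trans (+-identityʳ _) (+-identityʳ acc))
binVal-acc {suc n} acc (y ∷ ys) = trans (binVal-acc (2 * acc + bit y) ys)
  (trans (identity (2 ^ n) acc (bit y) (binVal 0 ys)) (cong (2 ^ suc n * acc +_) (sym (binVal-acc (bit y) ys))))
  where
  identity : ∀ P a b v → P * (2 * a + b) + v ≡ 2 * P * a + (P * b + v)
  identity = solve-∀

-- Starting from the opposite parity complements every output bit.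
prefixXor-complement : ∀ {n} b (xs : Vec Bool n) → suc (binVal 0 (prefixXor (not b) xs) + binVal 0 (prefixXor b xs)) ≡ 2 ^ n
prefixXor-complement b [] = refl
prefixXor-complement {suc n} b (x ∷ xs) rewrite sym (not-distribˡ-xor b x)
  | binVal-acc (bit (not (b xor x))) (prefixXor (not (b xor x)) xs) | binVal-acc (bit (b xor x)) (prefixXor (b xor x) xs) = begin
  suc (P * bit (not y) + v + (P * bit y + w))   ≡⟨ identity P (bit (not y)) (bit y) v w ⟩
  P * (bit (not y) + bit y) + suc (v + w)       ≡⟨ cong₂ (λ c d → P * c + d) (bits y) (prefixXor-complement y xs) ⟩
  P * 1 + P                                     ≡⟨ cong (_+ P) (*-identityʳ P) ⟩
  P + P                                         ≡⟨ 2^suc n ⟨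
  2 ^ suc n                                     ∎
  where
  open ≡-Reasoning
  P = 2 ^ n
  y = b xor x
  v = binVal 0 (prefixXor (not y) xs)
  w = binVal 0 (prefixXor y xs)
  bits : ∀ y → bit (not y) + bit y ≡ 1
  bits false = refl
  bits true  = refl
  identity : ∀ P a b v w → suc (P * a + v + (P * b + w)) ≡ P * (a + b) + suc (v + w)
  identity = solve-∀

-- The reflected construction: the second half of the code runs through the first in reverse. With
-- `gray (false ∷ w)` computing to `gray w`, this is the recursion on which the facts below rest.
gray-true : ∀ {n} (w : Vec Bool n) → suc (gray (true ∷ w) + gray w) ≡ 2 ^ suc n
gray-true {n} w = begin
  suc (binVal 1 (prefixXor true w) + gray w)                      ≡⟨ cong (λ x → suc (x + gray w)) (binVal-acc 1 (prefixXor true w)) ⟩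
  suc (2 ^ n * 1 + binVal 0 (prefixXor true w) + gray w)          ≡⟨ identity (2 ^ n) _ _ ⟩
  2 ^ n + suc (binVal 0 (prefixXor true w) + gray w)              ≡⟨ cong (2 ^ n +_) (prefixXor-complement false w) ⟩
  2 ^ n + 2 ^ n                                                   ≡⟨ 2^suc n ⟨
  2 ^ suc n                                                       ∎
  where
  open ≡-Reasoning
  identity : ∀ P v g → suc (P * 1 + v + g) ≡ P + suc (v + g)
  identity = solve-∀

gray< : ∀ {n} (u : Vec Bool n) → gray u < 2 ^ n
gray< [] = s≤s z≤n
gray< {suc n} (false ∷ w) = ≤-trans (gray< w) (m≤m+n (2 ^ n) _)
gray< {suc n} (true ∷ w)  = ≤-trans (s≤s (m≤m+n (gray (true ∷ w)) (gray w))) (≤-reflexive (gray-true w))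

gray-true≥ : ∀ {n} (w : Vec Bool n) → 2 ^ n ≤ gray (true ∷ w)
gray-true≥ {n} w = ≤-cancelling (2 ^ n) (+-monoʳ-≤ (gray (true ∷ w)) (gray< w)) 
  (sym (trans (+-suc (gray (true ∷ w)) (gray w)) (trans (gray-true w) (2^suc n)))) refl

gray-injective : ∀ {n} {u v : Vec Bool n} → gray u ≡ gray v → u ≡ v
gray-injective {u = []} {[]} eq = refl
gray-injective {u = false ∷ u} {false ∷ v} eq = cong (false ∷_) (gray-injective eq)
gray-injective {u = false ∷ u} {true ∷ v}  eq = contradiction (gray-true≥ v) (<⇒≱ (subst (_< _) eq (gray< u)))
gray-injective {u = true ∷ u}  {false ∷ v} eq = contradiction (gray-true≥ u) (<⇒≱ (subst (_< _) (sym eq) (gray< v)))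
gray-injective {u = true ∷ u}  {true ∷ v}  eq = cong (true ∷_) (gray-injective
  (+-cancelˡ-≡ (gray (true ∷ u)) _ _ (suc-injective (trans (gray-true u) (trans (sym (gray-true v)) (cong (λ x → suc (x + gray v)) (sym eq)))))))

gray-surjective : ∀ {n k} → k < 2 ^ n → ∃ λ (u : Vec Bool n) → gray u ≡ k
gray-surjective {zero} {zero} _ = [] , refl
gray-surjective {zero} {suc k} (s≤s ())
gray-surjective {suc n} {k} k< with k <? 2 ^ n
... | yes lo = let w , eq = gray-surjective lo in false ∷ w , eq
... | no  hi with complement k<
-- `k` lies in the upper half and is the mirror image of `k′`.
... | k′ , eq = let w , eq′ = gray-surjective k′< in
  true ∷ w , +-cancelʳ-≡ (gray w) _ _ (suc-injective (trans (gray-true w) (trans (sym eq) (cong (λ x → suc (k + x)) (sym eq′)))))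
  where
  k′< : k′ < 2 ^ n
  k′< = ≤-cancelling k (≤-trans (≤-reflexive (trans eq (2^suc n))) (+-monoʳ-≤ (2 ^ n) (≮⇒≥ hi))) (shape k k′) refl
    where
    shape : ∀ k k′ → suc k′ + k ≡ suc k + k′
    shape = solve-∀

grayEmbedding : ∀ n → Embedding n
grayEmbedding n = mk⤖ {to = to} (injective , surjective)
  where
  to : Vec Bool n → Fin (2 ^ n)
  to u = fromℕ< (gray< u)
  injective : ∀ {u v} → to u ≡ to v → u ≡ v
  injective {u} {v} eq = gray-injective (trans (sym (toℕ-fromℕ< (gray< u))) (trans (cong toℕ eq) (toℕ-fromℕ< (gray< v))))
  surjective : ∀ y → ∃ λ u → ∀ {z} → z ≡ u → to z ≡ y
  surjective y = let u , eq = gray-surjective (toℕ<n y) in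
    u , λ { refl → toℕ-injective (trans (toℕ-fromℕ< (gray< u)) eq) }

pos-grayEmbedding : ∀ n x → pos (grayEmbedding n) x ≡ ξ n x
pos-grayEmbedding n x = cong suc (toℕ-fromℕ< (gray< x))

-- The wirelength of the Gray code.

edges-cong : ∀ {n} {X Y : Set} (c : X → X → ℕ) (d : Y → Y → ℕ) {f : Vec Bool n → X} {g : Vec Bool n → Y} →
  (∀ u v → c (f u) (f v) ≡ d (g u) (g v)) → edges c f ≡ edges d g
edges-cong c d eq = ≤-antisym (edges-mono {c = c} {d} (λ u v → ≤-reflexive (eq u v))) (edges-mono {c = d} {c} (λ u v → ≤-reflexive (sym (eq u v))))

-- The sum of the first `2 ^ n` odd numbers, found without reordering: a word and its mirror image
-- contribute a constant together.
∑-odd : ∀ n → ∑ {n} (λ w → gray w + suc (gray w)) ≡ 2 ^ n * 2 ^ n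
∑-odd zero    = refl
∑-odd (suc n) = begin
  ∑ {n} (λ w → gray w + suc (gray w)) + ∑ {n} (λ w → gray (true ∷ w) + suc (gray (true ∷ w)))
    ≡⟨ ∑-+ {n} (λ w → gray w + suc (gray w)) (λ w → gray (true ∷ w) + suc (gray (true ∷ w))) ⟨
  ∑ {n} (λ w → gray w + suc (gray w) + (gray (true ∷ w) + suc (gray (true ∷ w))))
    ≡⟨ ∑-cong {n} (λ w → trans (identity (gray w) (gray (true ∷ w))) (cong (2 *_) (gray-true w))) ⟩
  ∑ {n} (λ _ → 2 * 2 ^ suc n)
    ≡⟨ ∑-const n (2 * 2 ^ suc n) ⟩
  2 ^ n * (2 * 2 ^ suc n)
    ≡⟨ identity₂ (2 ^ n) ⟩
  2 ^ suc n * 2 ^ suc n ∎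
  where
  open ≡-Reasoning
  identity : ∀ g h → g + suc g + (h + suc h) ≡ 2 * suc (h + g)
  identity = solve-∀
  identity₂ : ∀ P → P * (2 * (2 * P)) ≡ 2 * P * (2 * P)
  identity₂ = solve-∀

distance-reflect : ∀ {a b a′ b′} → a + a′ ≡ b + b′ → ∣ a - b ∣ ≡ ∣ a′ - b′ ∣
distance-reflect {a} {b} {a′} {b′} eq = begin
  ∣ a - b ∣                      ≡⟨ ∣m+n-m+o∣≡∣n-o∣ b′ a b ⟨
  ∣ b′ + a - b′ + b ∣            ≡⟨ cong (λ x → ∣ b′ + a - x ∣) (trans (+-comm b′ b) (sym eq)) ⟩
  ∣ b′ + a - a + a′ ∣            ≡⟨ cong (∣_- a + a′ ∣) (+-comm b′ a) ⟩
  ∣ a + b′ - a + a′ ∣            ≡⟨ ∣m+n-m+o∣≡∣n-o∣ a b′ a′ ⟩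
  ∣ b′ - a′ ∣                    ≡⟨ ∣-∣-comm b′ a′ ⟩
  ∣ a′ - b′ ∣                    ∎
  where open ≡-Reasoning

gray-true-distance : ∀ {n} (u v : Vec Bool n) → ∣ gray (true ∷ u) - gray (true ∷ v) ∣ ≡ ∣ gray u - gray v ∣
gray-true-distance u v = distance-reflect {gray (true ∷ u)} {gray (true ∷ v)} (suc-injective (trans (gray-true u) (sym (gray-true v))))

gray-false≤true : ∀ {n} (w : Vec Bool n) → gray w ≤ gray (true ∷ w)
gray-false≤true w = ≤-trans (<⇒≤ (gray< w)) (gray-true≥ w)

-- By reflection each distance is `2 ^ suc n` less an odd number, and `∑-odd` adds up those odd
-- numbers.
∑-cross : ∀ n → ∑ {n} (λ w → ∣ gray w - gray (true ∷ w) ∣) ≡ 2 ^ n * 2 ^ n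
∑-cross n = +-cancelʳ-≡ (∑ {n} (λ w → gray w + suc (gray w))) _ _ (begin
  ∑ {n} (λ w → ∣ gray w - gray (true ∷ w) ∣) + ∑ {n} (λ w → gray w + suc (gray w))
    ≡⟨ ∑-+ {n} (λ w → ∣ gray w - gray (true ∷ w) ∣) (λ w → gray w + suc (gray w)) ⟨
  ∑ {n} (λ w → ∣ gray w - gray (true ∷ w) ∣ + (gray w + suc (gray w)))
    ≡⟨ ∑-cong pointwise ⟩
  ∑ {n} (λ _ → 2 ^ suc n)
    ≡⟨ ∑-const n (2 ^ suc n) ⟩
  2 ^ n * 2 ^ suc n
    ≡⟨ trans (cong (2 ^ n *_) (2^suc n)) (*-distribˡ-+ (2 ^ n) (2 ^ n) (2 ^ n)) ⟩
  2 ^ n * 2 ^ n + 2 ^ n * 2 ^ n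
    ≡⟨ cong (2 ^ n * 2 ^ n +_) (∑-odd n) ⟨
  2 ^ n * 2 ^ n + ∑ {n} (λ w → gray w + suc (gray w)) ∎)
  where
  open ≡-Reasoning
  pointwise : ∀ (w : Vec Bool n) → ∣ gray w - gray (true ∷ w) ∣ + (gray w + suc (gray w)) ≡ 2 ^ suc n
  pointwise w = begin
    ∣ gray w - gray (true ∷ w) ∣ + (gray w + suc (gray w))
      ≡⟨ cong (_+ (gray w + suc (gray w))) (m≤n⇒∣m-n∣≡n∸m (gray-false≤true w)) ⟩
    gray (true ∷ w) ∸ gray w + (gray w + suc (gray w))
      ≡⟨ +-assoc (gray (true ∷ w) ∸ gray w) (gray w) _ ⟨
    gray (true ∷ w) ∸ gray w + gray w + suc (gray w)
      ≡⟨ cong (_+ suc (gray w)) (m∸n+n≡m (gray-false≤true w)) ⟩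
    gray (true ∷ w) + suc (gray w)
      ≡⟨ trans (+-suc (gray (true ∷ w)) (gray w)) (gray-true w) ⟩
    2 ^ suc n ∎

-- On a path the two halves of the code are mirror images, and the edges between them add
-- `2 ^ n * 2 ^ n` by `∑-cross`.
linear-wirelength : ∀ n → 2 * edges ∣_-_∣ (gray {n}) + 2 ^ n ≡ 2 ^ n * 2 ^ n
linear-wirelength zero    = refl
linear-wirelength (suc n) = begin
  2 * (L + edges {n} ∣_-_∣ (λ w → gray (true ∷ w)) + ∑ {n} (λ w → ∣ gray w - gray (true ∷ w) ∣)) + 2 * P
    ≡⟨ cong₂ (λ x y → 2 * (L + x + y) + 2 * P) (edges-cong {n} ∣_-_∣ ∣_-_∣ {λ w → gray (true ∷ w)} {gray} gray-true-distance) (∑-cross n) ⟩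
  2 * (L + L + P * P) + 2 * P
    ≡⟨ identity₁ L P ⟩
  2 * (2 * L + P) + 2 * (P * P)
    ≡⟨ cong (λ x → 2 * x + 2 * (P * P)) (linear-wirelength n) ⟩
  2 * (P * P) + 2 * (P * P)
    ≡⟨ identity₂ P ⟩
  2 * P * (2 * P) ∎
  where
  open ≡-Reasoning
  P = 2 ^ n
  L = edges ∣_-_∣ (gray {n})
  identity₁ : ∀ L P → 2 * (L + L + P * P) + 2 * P ≡ 2 * (2 * L + P) + 2 * (P * P)
  identity₁ = solve-∀
  identity₂ : ∀ P → 2 * (P * P) + 2 * (P * P) ≡ 2 * P * (2 * P)
  identity₂ = solve-∀

cycDist-short : ∀ {N a b} → ∣ a - b ∣ + ∣ a - b ∣ ≤ N → cycDist N a b ≡ ∣ a - b ∣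
cycDist-short {N} {a} {b} le = m≤n⇒m⊓n≡m (m+n≤o⇒m≤o∸n ∣ a - b ∣ le)

cycDist-half : ∀ n {a b} → ∣ a - b ∣ ≤ 2 ^ n → cycDist (2 ^ suc n) a b ≡ ∣ a - b ∣
cycDist-half n {a} {b} le = cycDist-short {2 ^ suc n} {a} {b} (≤-trans (+-mono-≤ le le) (≤-reflexive (sym (2^suc n))))

∣gray-gray∣≤ : ∀ {n} (u v : Vec Bool n) → ∣ gray u - gray v ∣ ≤ 2 ^ n
∣gray-gray∣≤ u v = ≤-trans (∣m-n∣≤m⊔n (gray u) (gray v)) (⊔-lub (<⇒≤ (gray< u)) (<⇒≤ (gray< v)))

-- The two words lie symmetrically about the seam of the cycle, so the shorter way wraps around.
cross-low : ∀ {m} (w : Vec Bool m) → cycDist (2 ^ suc (suc m)) (gray w) (gray (true ∷ false ∷ w)) ≡ gray w + suc (gray w)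
cross-low {m} w with complement {gray w} {gray (true ∷ false ∷ w)} (gray-false≤true (false ∷ w))
... | d , eq rewrite sym eq | ∣m-m+n∣≡n (gray w) d = trans (cong (d ⊓_) rest) (m≥n⇒m⊓n≡n odd≤d)
  where
  total : d + (gray w + suc (gray w)) ≡ 2 ^ suc (suc m)
  total = trans (shape d (gray w)) (trans (cong (λ x → suc (x + gray w)) eq) (gray-true (false ∷ w)))
    where
    shape : ∀ d g → d + (g + suc g) ≡ suc (g + d + g)
    shape = solve-∀
  rest : 2 ^ suc (suc m) ∸ d ≡ gray w + suc (gray w)
  rest = trans (cong (_∸ d) (sym total)) (m+n∸m≡n d _)
  odd≤ : gray w + suc (gray w) ≤ 2 ^ suc m
  odd≤ = ≤-trans (+-mono-≤ (<⇒≤ (gray< w)) (gray< w)) (≤-reflexive (sym (2^suc m)))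
  odd≤d : gray w + suc (gray w) ≤ d
  odd≤d = ≤-cancelling (gray w + suc (gray w)) (+-mono-≤ odd≤ odd≤) refl (trans (sym (2^suc (suc m))) (sym total))

-- Here the two words lie symmetrically about the middle, and the direct way is the shorter one.
cross-high : ∀ {m} (w : Vec Bool m) → cycDist (2 ^ suc (suc m)) (gray (true ∷ w)) (gray (true ∷ true ∷ w)) ≡ gray w + suc (gray w)
cross-high {m} w = trans (cycDist-half (suc m) {gray (true ∷ w)} {gray (true ∷ true ∷ w)} (subst (_≤ 2 ^ suc m) (sym gap) odd≤)) gap
  where
  odd≤ : gray w + suc (gray w) ≤ 2 ^ suc m
  odd≤ = ≤-trans (+-mono-≤ (<⇒≤ (gray< w)) (gray< w)) (≤-reflexive (sym (2^suc m)))
  shift : gray (true ∷ true ∷ w) ≡ gray (true ∷ w) + (gray w + suc (gray w))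
  shift = +-cancelʳ-≡ (suc (gray (true ∷ w))) _ _ (begin
    gray (true ∷ true ∷ w) + suc (gray (true ∷ w))      ≡⟨ +-suc (gray (true ∷ true ∷ w)) (gray (true ∷ w)) ⟩
    suc (gray (true ∷ true ∷ w) + gray (true ∷ w))      ≡⟨ gray-true (true ∷ w) ⟩
    2 ^ suc (suc m)                                     ≡⟨ 2^suc (suc m) ⟩
    2 ^ suc m + 2 ^ suc m                               ≡⟨ cong (λ x → x + x) (gray-true w) ⟨
    suc (gray (true ∷ w) + gray w) + suc (gray (true ∷ w) + gray w)  ≡⟨ shape (gray (true ∷ w)) (gray w) ⟩
    gray (true ∷ w) + (gray w + suc (gray w)) + suc (gray (true ∷ w)) ∎)
    where
    open ≡-Reasoning
    shape : ∀ h g → suc (h + g) + suc (h + g) ≡ h + (g + suc g) + suc h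
    shape = solve-∀
  gap : ∣ gray (true ∷ w) - gray (true ∷ true ∷ w) ∣ ≡ gray w + suc (gray w)
  gap = trans (cong (∣ gray (true ∷ w) -_∣) shift) (∣m-m+n∣≡n (gray (true ∷ w)) (gray w + suc (gray w)))

-- Each facet of the first coordinate fills half of the cycle, where cyclic and linear distance
-- agree. The edges across are split by the second coordinate into `cross-low` and `cross-high`.
gray-wirelength : ∀ m → edges (cycDist (2 ^ suc (suc m))) (ξ (suc (suc m))) + 2 ^ suc m ≡ 6 * (2 ^ m * 2 ^ m)
gray-wirelength m = begin
  edges {suc m} cyc (λ w → suc (gray (false ∷ w))) + edges {suc m} cyc (λ w → suc (gray (true ∷ w)))
      + (∑ {m} (λ w → cyc (gray w) (gray (true ∷ false ∷ w))) + ∑ {m} (λ w → cyc (gray (true ∷ w)) (gray (true ∷ true ∷ w)))) + 2 * M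
    ≡⟨ cong₂ (λ x y → x + y + 2 * M)
         (cong₂ _+_ (edges-cong {suc m} cyc ∣_-_∣ {λ w → suc (gray w)} {gray} (λ u v → cycDist-half (suc m) {gray u} {gray v} (∣gray-gray∣≤ u v)))
                    (edges-cong {suc m} cyc ∣_-_∣ {λ w → suc (gray (true ∷ w))} {gray} (λ u v → trans
                      (cycDist-half (suc m) {gray (true ∷ u)} {gray (true ∷ v)} (subst (_≤ 2 ^ suc m) (sym (gray-true-distance u v)) (∣gray-gray∣≤ u v)))
                      (gray-true-distance u v))))
         (cong₂ _+_ (trans (∑-cong {m} cross-low) (∑-odd m)) (trans (∑-cong {m} cross-high) (∑-odd m))) ⟩
  L + L + (M * M + M * M) + 2 * M
    ≡⟨ identity₁ L M ⟩
  2 * L + 2 * M + 2 * (M * M)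
    ≡⟨ cong (_+ 2 * (M * M)) (linear-wirelength (suc m)) ⟩
  2 * M * (2 * M) + 2 * (M * M)
    ≡⟨ identity₂ M ⟩
  6 * (M * M) ∎
  where
  open ≡-Reasoning
  M = 2 ^ m
  cyc = cycDist (2 ^ suc (suc m))
  L = edges ∣_-_∣ (gray {suc m})
  identity₁ : ∀ L M → L + L + (M * M + M * M) + 2 * M ≡ 2 * L + 2 * M + 2 * (M * M)
  identity₁ = solve-∀
  identity₂ : ∀ M → 2 * M * (2 * M) + 2 * (M * M) ≡ 6 * (M * M)
  identity₂ = solve-∀

-- With `n = m + 2` the exponents `2n - 3` and `n - 1` are `2m + 1` and `m + 1`, so no truncation
-- occurs in them.
optimum : ∀ m → 3 * 2 ^ (2 * suc (suc m) ∸ 3) ∸ 2 ^ (suc (suc m) ∸ 1) ≡ 6 * (2 ^ m * 2 ^ m) ∸ 2 ^ suc m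
optimum m = cong (_∸ 2 ^ suc m) (begin
  3 * 2 ^ (2 * suc (suc m) ∸ 3)      ≡⟨ cong (λ x → 3 * 2 ^ (x ∸ 3)) (exponent m) ⟩
  3 * (2 * 2 ^ (m + m))              ≡⟨ cong (λ x → 3 * (2 * x)) (^-distribˡ-+-* 2 m m) ⟩
  3 * (2 * (2 ^ m * 2 ^ m))          ≡⟨ *-assoc 3 2 (2 ^ m * 2 ^ m) ⟨
  6 * (2 ^ m * 2 ^ m)                ∎)
  where
  open ≡-Reasoning
  exponent : ∀ m → 2 * suc (suc m) ≡ 3 + suc (m + m)
  exponent = solve-∀

theorem1p1 : (n : ℕ) → 2 ≤ n →
    Σ (Embedding n) (λ η → (x : _) → pos η x ≡ ξ n x) ×
    (WLfun n (ξ n) ≡ 3 * 2 ^ (2 * n ∸ 3) ∸ 2 ^ (n ∸ 1)) ×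
    ((η : Embedding n) → 3 * 2 ^ (2 * n ∸ 3) ∸ 2 ^ (n ∸ 1) ≤ WL n η)
theorem1p1 n@(suc (suc m)) (s≤s (s≤s z≤n)) =
  -- An embedding with positions `ξ n` exists, so the bound is attained by an admissible layout.
  (grayEmbedding n , pos-grayEmbedding n) ,
  trans (WLfun≡edges n (ξ n)) (trans (trans (sym (m+n∸n≡m _ (2 ^ suc m))) (cong (_∸ 2 ^ suc m) (gray-wirelength m))) (sym (optimum m))) ,
  lower
  where
  lower : (η : Embedding n) → 3 * 2 ^ (2 * n ∸ 3) ∸ 2 ^ (n ∸ 1) ≤ WL n η
  lower η = begin
    3 * 2 ^ (2 * n ∸ 3) ∸ 2 ^ (n ∸ 1)                ≡⟨ optimum m ⟩
    6 * (2 ^ m * 2 ^ m) ∸ 2 ^ suc m                  ≤⟨ ∸-monoˡ-≤ (2 ^ suc m) wirelength-≥ ⟩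
    edges (cycDist (2 ^ n)) (pos η) + 2 ^ suc m ∸ 2 ^ suc m  ≡⟨ m+n∸n≡m _ (2 ^ suc m) ⟩
    edges (cycDist (2 ^ n)) (pos η)                  ≡⟨ WLfun≡edges n (pos η) ⟨
    WL n η                                           ∎
    where
    open ≤-Reasoning
    open Bijection η using (to; injective; surjective)
    reached : ∀ {k} → k < 2 ^ n → ∃ λ u → toℕ (to u) ≡ k
    reached k< = let u , hits = surjective (fromℕ< k<) in u , trans (cong toℕ (hits refl)) (toℕ-fromℕ< k<)
    -- `Layout` counts positions from `0`; `pos η` is their successor, as in `wirelength-≥`.
    open Layout m (λ u → toℕ (to u)) (λ u → toℕ<n (to u)) (λ eq → injective (toℕ-injective eq)) reached
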